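{- For $m\ge 1$ and $0\le a\le m$, \[ \frac{ (q^{a+1},q^{m+1-a},q^{m+2};q^{m+2})_\infty}{(q;q)_\infty (q;q^2)_{\infty}} =\sum_{N_1,\ldots, N_m\ge 0}\frac{q^{\sum_{i=1}^{m}\binom{N_i+1}{2}}}{(q;q)_{N_1}}\begin{bmatrix}N_1+\delta_{a,1}\\ N_2\end{bmatrix}\begin{bmatrix}N_2+\delta_{a,2}\\ N_3\end{bmatrix}\cdots \begin{bmatrix}N_{m-1}+\delta_{a,m-1}\\ N_{m}\end{bmatrix}, \] where $\delta$ is the Kronecker delta.
   Context: $(z;q)_\infty=\prod_{j\ge0}(1-zq^j)$, $(z;q)_n=\prod_{j=0}^{n-1}(1-zq^j)$, $(a_1,\ldots,a_r;q)_\infty=\prod_i(a_i;q)_\infty$; $\begin{bmatrix} N\\ M\end{bmatrix}=\frac{(q;q)_N}{(q;q)_M(q;q)_{N-M}}$ for $0\le M\le N$ and $0$ otherwise. -}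

module Defs where

open import Data.Nat as ℕ using (ℕ; zero; suc; _∸_; _≤_; _≤?_; _≡ᵇ_)
open import Data.Nat.Combinatorics using (_C_)
open import Data.Integer as ℤ using (ℤ; +_; 0ℤ; 1ℤ)
open import Data.List using (List; []; _∷_; map; upTo; concatMap; foldr)
open import Data.Vec using (Vec; []; _∷_; lookup)
open import Data.Fin using (Fin)
open import Data.Bool using (if_then_else_)
open import Data.Product using (∃; _×_)
open import Relation.Nullary using (¬_; yes; no)
open import Relation.Binary.PropositionalEquality using (_≡_)

-- Formal power series in q with integer coefficients: n ↦ coefficient of q^n.
PS : Set
PS = ℕ → ℤ

sumℤ : List ℤ → ℤ
sumℤ = foldr ℤ._+_ 0ℤ

one : PS
one zero    = 1ℤ
one (suc _) = 0ℤ

X^ : ℕ → PS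
X^ k n = if k ≡ᵇ n then 1ℤ else 0ℤ

_⊕_ : PS → PS → PS
(f ⊕ g) n = f n ℤ.+ g n

_⊖_ : PS → PS → PS
(f ⊖ g) n = f n ℤ.- g n

infixl 6 _⊕_ _⊖_
infixl 7 _⊛_

_⊛_ : PS → PS → PS
(f ⊛ g) n = sumℤ (map (λ k → f k ℤ.* g (n ∸ k)) (upTo (suc n)))

_^ps_ : PS → ℕ → PS
f ^ps zero  = one
f ^ps suc k = f ⊛ (f ^ps k)

-- Inverse of a series f with constant term 1: 1/f = Σ_k (1 - f)^k;
-- since 1 - f has zero constant term, only k ≤ n contribute to q^n.
inv : PS → PS
inv f n = sumℤ (map (λ k → ((one ⊖ f) ^ps k) n) (upTo (suc n)))

qPoch : ℕ → ℕ → ℕ → PS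
qPoch c d zero    = one
qPoch c d (suc N) = qPoch c d N ⊛ (one ⊖ X^ (c ℕ.+ d ℕ.* N))

-- infinite q-Pochhammer (q^c ; q^d)_∞ for c ≥ 1, d ≥ 1 (q-adic limit):
-- factors with j ≥ n have exponent c + d j > n, so the coefficient of q^n
-- is that of the finite product with n+1 factors.
qPochInf : ℕ → ℕ → PS
qPochInf c d n = qPoch c d (suc n) n

qq : ℕ → PS
qq = qPoch 1 1

qbin : ℕ → ℕ → PS
qbin N M with M ≤? N
... | yes _ = qq N ⊛ inv (qq M) ⊛ inv (qq (N ∸ M))
... | no  _ = λ _ → 0ℤ

δ : ℕ → ℕ → ℕ
δ a i = if a ≡ᵇ i then 1 else 0

box : ℕ → (m : ℕ) → List (Vec ℕ m)
box B zero    = [] ∷ []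
box B (suc m) = concatMap (λ x → map (x ∷_) (box B m)) (upTo (suc B))

-- q-adic sum of a family of series indexed by ℕ^m:
-- S = Σ_N F N iff for each n there is a bound B such that every term with a
-- nonzero q^n-coefficient has all indices ≤ B, and the q^n-coefficient of S
-- equals the finite sum over the box {0..B}^m.
IsSum : {m : ℕ} → (Vec ℕ m → PS) → PS → Set
IsSum {m} F S = ∀ n → ∃ λ B →
  (∀ N → ¬ (F N n ≡ 0ℤ) → ∀ (i : Fin m) → lookup N i ≤ B)
  × (S n ≡ sumℤ (map (λ N → F N n) (box B m)))

sumBinom : {m : ℕ} → Vec ℕ m → ℕ
sumBinom []      = 0
sumBinom (x ∷ v) = (suc x C 2) ℕ.+ sumBinom v

-- Π_{i ≥ i₀} [N_i + δ_{a,i} over N_{i+1}], the vector starting at index i₀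
chain : ℕ → ℕ → {k : ℕ} → Vec ℕ k → PS
chain a i []            = one
chain a i (x ∷ [])      = one
chain a i (x ∷ y ∷ v)   = qbin (x ℕ.+ δ a i) y ⊛ chain a (suc i) (y ∷ v)

firstFactor : {k : ℕ} → Vec ℕ k → PS
firstFactor []      = one
firstFactor (x ∷ _) = inv (qq x)

summand : (a : ℕ) → {m : ℕ} → Vec ℕ m → PS
summand a N = X^ (sumBinom N) ⊛ firstFactor N ⊛ chain a 1 N

lhs : ℕ → ℕ → PS
lhs m a = qPochInf (suc a) (m ℕ.+ 2) ⊛ qPochInf (m ℕ.+ 1 ∸ a) (m ℕ.+ 2)
          ⊛ qPochInf (m ℕ.+ 2) (m ℕ.+ 2)
          ⊛ inv (qPochInf 1 1) ⊛ inv (qPochInf 1 2)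

{-# OPTIONS --safe #-}
module Submission where

-- Everything is computed modulo q^(n+1), where all sums and products become finite.
--
-- Write (q)_k = (q;q)_k and F α x = Σ_j α_j / ((q)_(x-j) (q)_(x+1+j)).  Bailey's lemma with
-- parameters -q and ∞ (a case of q-Chu-Vandermonde) says that one summation against
-- q^(s(s+1)/2) [x, s] turns (q)_x (-q)_x F α x into the same expression with α_j replaced by
-- q^(j(j+1)/2) α_j.  Starting from the unit pair this evaluates the sums over N_m, …, N_(a+1).
-- The Kronecker delta evaluates the result at x + 1 instead of x, and
--   (1 - q^(2x+2)) F α (x + 1) = F α′ x
-- for the explicit α′ obtained by replacing j(j+1)/2 by j(j-1)/2 in the bilateral exponent.
-- Summing over N_a, …, N_1 and letting x → ∞ leaves (-q)_∞ / (q)_∞ times a theta series, which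
-- the Jacobi triple product evaluates; finally (-q;q)_∞ (q;q²)_∞ = 1.

open import Defs
open import Algebra.Bundles using (CommutativeRing)
import Algebra.Solver.Ring
import Algebra.Solver.Ring.AlmostCommutativeRing as ACR
open import Algebra.Structures using (IsCommutativeRing)
open import Data.Fin using (zero; suc)
open import Data.Integer as ℤ using (ℤ; +_; -[1+_]; 0ℤ; 1ℤ)
import Data.Integer.Properties as ℤₚ
open import Data.Integer.Solver using (module +-*-Solver)
open import Data.List using (List; []; _∷_; _++_; map; upTo; concatMap; applyUpTo)
open import Data.List.Properties using (map-upTo; map-++; map-∘)
open import Data.Maybe using (Maybe; just; nothing)
open import Data.Nat as ℕ using (ℕ; zero; suc; _∸_; _≤_; _<_; z≤n; s≤s)
open import Data.Nat.Combinatorics using (_C_; nC1≡n; nCk+nC[k+1]≡[n+1]C[k+1])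
import Data.Nat.Properties as ℕₚ
open import Data.Product using (∃; _,_)
open import Data.Sum as Sum using (inj₁; inj₂)
open import Data.Vec using (Vec; []; _∷_; lookup)
open import Function using (_∘_)
open import Level using (0ℓ)
open import Relation.Nullary using (yes; no; contradiction)
open import Relation.Binary.PropositionalEquality as ≡ using (_≡_)

-- The three exponents on the product side count steps. With i = j or i = -j-1 the unit pair has
-- weight (-1)^i q^(i(i-1)/2), and each Bailey step adds i(i+1)/2 to the exponent. One step only
-- produces the constant 1 of the empty chain, and m - a steps follow. The shift turns m - a copies
-- of i(i+1)/2 into i(i-1)/2, and a further steps lead to (a+1)·i(i+1)/2 + (m+1-a)·i(i-1)/2. This is
-- the theta series of base q^(m+2) with z = q^(a+1) and w = q^(m+1-a). Three bases occur, q, q^2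
-- and q^(m+2), and one can divide only by units. So the q-series identities are proved for an
-- arbitrary element q of an arbitrary commutative ring, reciprocals of (q)_k are extra data, and
-- Gaussian binomials come from Pascal's rule. Infinity is replaced by 2n: modulo q^(n+1) Pochhammer
-- products are constant from n factors on, and 2n - j is still at least n when j ≤ n.

module IntegerSolver {c ℓ} (R : CommutativeRing c ℓ) where
  open CommutativeRing R
  open import Algebra.Properties.Semiring.Mult.TCOptimised semiring
  open import Algebra.Properties.Ring ring using (-‿distribˡ-*; -‿distribʳ-*)
  open import Algebra.Properties.AbelianGroup +-abelianGroup
    using (⁻¹-∙-comm; ⁻¹-involutive; ε⁻¹≈ε)
  open import Relation.Binary.Reasoning.Setoid setoid

  ⟦_⟧ℤ : ℤ → Carrier
  ⟦ + n ⟧ℤ      = n × 1#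
  ⟦ -[1+ n ] ⟧ℤ = - (suc n × 1#)

  ⊖-homo : ∀ m n → ⟦ m ℤ.⊖ n ⟧ℤ ≈ m × 1# - n × 1#
  ⊖-homo m       zero    = sym (trans (+-congˡ ε⁻¹≈ε) (+-identityʳ _))
  ⊖-homo zero    (suc n) = sym (+-identityˡ _)
  ⊖-homo (suc m) (suc n) = begin
    ⟦ suc m ℤ.⊖ suc n ⟧ℤ                     ≡⟨ ≡.cong ⟦_⟧ℤ (ℤₚ.[1+m]⊖[1+n]≡m⊖n m n) ⟩
    ⟦ m ℤ.⊖ n ⟧ℤ                             ≈⟨ ⊖-homo m n ⟩
    m × 1# - n × 1#                        ≈⟨ +-congʳ (+-identityˡ _) ⟨
    (0# + m × 1#) - n × 1#                 ≈⟨ +-congʳ (+-congʳ (-‿inverseʳ 1#)) ⟨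
    ((1# - 1#) + m × 1#) - n × 1#          ≈⟨ +-congʳ (+-assoc _ _ _) ⟩
    (1# + (- 1# + m × 1#)) - n × 1#        ≈⟨ +-congʳ (+-congˡ (+-comm _ _)) ⟩
    (1# + (m × 1# - 1#)) - n × 1#          ≈⟨ +-congʳ (+-assoc _ _ _) ⟨
    ((1# + m × 1#) - 1#) - n × 1#          ≈⟨ +-assoc _ _ _ ⟩
    (1# + m × 1#) + (- 1# - n × 1#)        ≈⟨ +-congˡ (⁻¹-∙-comm _ _) ⟩
    (1# + m × 1#) - (1# + n × 1#)          ≈⟨ +-cong (1+× m 1#) (-‿cong (1+× n 1#)) ⟨
    suc m × 1# - suc n × 1#                ∎

  +-homoℤ : ∀ i j → ⟦ i ℤ.+ j ⟧ℤ ≈ ⟦ i ⟧ℤ + ⟦ j ⟧ℤ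
  +-homoℤ (+ m)      (+ n)      = ×-homo-+ 1# m n
  +-homoℤ (+ m)      (-[1+ n ]) = ⊖-homo m (suc n)
  +-homoℤ (-[1+ m ]) (+ n)      = trans (⊖-homo n (suc m)) (+-comm _ _)
  +-homoℤ (-[1+ m ]) (-[1+ n ]) = begin
    - (suc (suc (m ℕ.+ n)) × 1#)          ≡⟨ ≡.cong (λ k → - (k × 1#)) (≡.cong suc (ℕₚ.+-suc m n)) ⟨
    - ((suc m ℕ.+ suc n) × 1#)            ≈⟨ -‿cong (×-homo-+ 1# (suc m) (suc n)) ⟩
    - (suc m × 1# + suc n × 1#)           ≈⟨ ⁻¹-∙-comm _ _ ⟨
    - (suc m × 1#) - suc n × 1#           ∎

  -‿homoℤ : ∀ i → ⟦ ℤ.- i ⟧ℤ ≈ - ⟦ i ⟧ℤ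
  -‿homoℤ (+ zero)   = sym ε⁻¹≈ε
  -‿homoℤ (+ suc n)  = refl
  -‿homoℤ (-[1+ n ]) = sym (⁻¹-involutive _)

  *-homoℤ⁺ : ∀ m j → ⟦ + m ℤ.* j ⟧ℤ ≈ m × 1# * ⟦ j ⟧ℤ
  *-homoℤ⁺ m (+ n) = begin
    ⟦ + m ℤ.* + n ⟧ℤ       ≡⟨ ≡.cong ⟦_⟧ℤ (ℤₚ.pos-* m n) ⟨
    (m ℕ.* n) × 1#         ≈⟨ ×1-homo-* m n ⟩
    m × 1# * n × 1#        ∎
  *-homoℤ⁺ m (-[1+ n ]) = begin
    ⟦ + m ℤ.* -[1+ n ] ⟧ℤ       ≡⟨ ≡.cong ⟦_⟧ℤ (ℤₚ.neg-distribʳ-* (+ m) (+ suc n)) ⟨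
    ⟦ ℤ.- (+ m ℤ.* + suc n) ⟧ℤ  ≈⟨ -‿homoℤ (+ m ℤ.* + suc n) ⟩
    - ⟦ + m ℤ.* + suc n ⟧ℤ      ≈⟨ -‿cong (*-homoℤ⁺ m (+ suc n)) ⟩
    - (m × 1# * suc n × 1#)     ≈⟨ -‿distribʳ-* _ _ ⟩
    m × 1# * - (suc n × 1#)     ∎

  *-homoℤ : ∀ i j → ⟦ i ℤ.* j ⟧ℤ ≈ ⟦ i ⟧ℤ * ⟦ j ⟧ℤ
  *-homoℤ (+ m)      j = *-homoℤ⁺ m j
  *-homoℤ (-[1+ m ]) j = begin
    ⟦ -[1+ m ] ℤ.* j ⟧ℤ         ≡⟨ ≡.cong ⟦_⟧ℤ (ℤₚ.neg-distribˡ-* (+ suc m) j) ⟨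
    ⟦ ℤ.- (+ suc m ℤ.* j) ⟧ℤ    ≈⟨ -‿homoℤ (+ suc m ℤ.* j) ⟩
    - ⟦ + suc m ℤ.* j ⟧ℤ        ≈⟨ -‿cong (*-homoℤ⁺ (suc m) j) ⟩
    - (suc m × 1# * ⟦ j ⟧ℤ)     ≈⟨ -‿distribˡ-* _ _ ⟩
    - (suc m × 1#) * ⟦ j ⟧ℤ     ∎

  ℤ-morphism : ℤ.+-*-rawRing ACR.-Raw-AlmostCommutative⟶ ACR.fromCommutativeRing R
  ℤ-morphism = record
    { ⟦_⟧    = ⟦_⟧ℤ
    ; +-homo = +-homoℤ
    ; *-homo = *-homoℤ
    ; -‿homo = -‿homoℤ
    ; 0-homo = refl
    ; 1-homo = refl
    }

  -- `R` is arbitrary and carries no equality test, so the solver takes its coefficients from ℤ,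
  -- where the test suffices to cancel like terms.
  coeff≟ : ∀ i j → Maybe (⟦ i ⟧ℤ ≈ ⟦ j ⟧ℤ)
  coeff≟ i j with i ℤₚ.≟ j
  ... | yes i≡j = just (reflexive (≡.cong ⟦_⟧ℤ i≡j))
  ... | no  _   = nothing

  open Algebra.Solver.Ring ℤ.+-*-rawRing (ACR.fromCommutativeRing R) ℤ-morphism coeff≟ public
    using (solve; Polynomial; con; _:+_; _:*_; _:-_; :-_; _:=_)

  :1 : ∀ {n} → Polynomial n
  :1 = con (+ 1)

-- Finite sums in a commutative ring.

module FiniteSums {c ℓ} (R : CommutativeRing c ℓ) where
  open CommutativeRing R
  open IntegerSolver R
  open import Relation.Binary.Reasoning.Setoid setoid

  opaque
    -- Opaque, so that a sum with bound `suc n` is not unfolded during unification; outside the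
    -- block `∑-empty` and `∑-first` do the unfolding.
    ∑ : ℕ → (ℕ → Carrier) → Carrier
    ∑ zero    f = 0#
    ∑ (suc n) f = f 0 + ∑ n (λ k → f (suc k))

    ∑-empty : ∀ f → ∑ 0 f ≈ 0#
    ∑-empty f = refl

    ∑-first : ∀ n f → ∑ (suc n) f ≈ f 0 + ∑ n (λ k → f (suc k))
    ∑-first n f = refl

    ∑-cong : ∀ n {f g : ℕ → Carrier} → (∀ k → k < n → f k ≈ g k) → ∑ n f ≈ ∑ n g
    ∑-cong zero    f≈g = refl
    ∑-cong (suc n) f≈g = +-cong (f≈g 0 (s≤s z≤n)) (∑-cong n (λ k k<n → f≈g (suc k) (s≤s k<n)))

    ∑-zero : ∀ n {f : ℕ → Carrier} → (∀ k → k < n → f k ≈ 0#) → ∑ n f ≈ 0#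
    ∑-zero zero    f≈0 = refl
    ∑-zero (suc n) f≈0 = trans
      (+-cong (f≈0 0 (s≤s z≤n)) (∑-zero n (λ k k<n → f≈0 (suc k) (s≤s k<n))))
      (+-identityˡ 0#)

    ∑-split : ∀ m n (f : ℕ → Carrier) → ∑ (m ℕ.+ n) f ≈ ∑ m f + ∑ n (λ k → f (m ℕ.+ k))
    ∑-split zero    n f = sym (+-identityˡ _)
    ∑-split (suc m) n f = trans (+-congˡ (∑-split m n (λ k → f (suc k)))) (sym (+-assoc _ _ _))

    ∑-last : ∀ n (f : ℕ → Carrier) → ∑ (suc n) f ≈ ∑ n f + f n
    ∑-last zero    f = +-comm _ _
    ∑-last (suc n) f = trans (+-congˡ (∑-last n (λ k → f (suc k)))) (sym (+-assoc _ _ _))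

    ∑-distrib-+ : ∀ n (f g : ℕ → Carrier) → ∑ n (λ k → f k + g k) ≈ ∑ n f + ∑ n g
    ∑-distrib-+ zero    f g = sym (+-identityˡ 0#)
    ∑-distrib-+ (suc n) f g = trans
      (+-congˡ (∑-distrib-+ n (λ k → f (suc k)) (λ k → g (suc k))))
      (solve 4 (λ a b c d → (a :+ b) :+ (c :+ d) := (a :+ c) :+ (b :+ d)) refl _ _ _ _)

    *-distribˡ-∑ : ∀ x n (f : ℕ → Carrier) → x * ∑ n f ≈ ∑ n (λ k → x * f k)
    *-distribˡ-∑ x zero    f = zeroʳ x
    *-distribˡ-∑ x (suc n) f = trans (distribˡ _ _ _) (+-congˡ (*-distribˡ-∑ x n (λ k → f (suc k))))

    ∑-swap : ∀ m n (f : ℕ → ℕ → Carrier) →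
             ∑ m (λ i → ∑ n (λ j → f i j)) ≈ ∑ n (λ j → ∑ m (λ i → f i j))
    ∑-swap zero    n f = sym (∑-zero n (λ _ _ → refl))
    ∑-swap (suc m) n f = trans (+-congˡ (∑-swap m n (λ i → f (suc i)))) (sym (∑-distrib-+ n _ _))

    ∑-reverse : ∀ n (f : ℕ → Carrier) → ∑ n f ≈ ∑ n (λ k → f (n ∸ suc k))
    ∑-reverse zero    f = refl
    ∑-reverse (suc n) f = trans (∑-last n f) (trans (+-comm _ _) (+-congˡ (∑-reverse n f)))

    ∑-telescope : ∀ n (t : ℕ → Carrier) → ∑ n (λ k → t k - t (suc k)) ≈ t 0 - t n
    ∑-telescope zero    t = sym (-‿inverseʳ _)
    ∑-telescope (suc n) t = trans (+-congˡ (∑-telescope n (λ k → t (suc k))))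
      (solve 3 (λ a b c → (a :- b) :+ (b :- c) := a :- c) refl _ _ _)

  ∑-extend : ∀ {m n} {f : ℕ → Carrier} → (∀ k → m ≤ k → f k ≈ 0#) → m ≤ n → ∑ n f ≈ ∑ m f
  ∑-extend {m} {n} {f} f≈0 m≤n = begin
    ∑ n f                                       ≡⟨ ≡.cong (λ k → ∑ k f) (ℕₚ.m+[n∸m]≡n m≤n) ⟨
    ∑ (m ℕ.+ (n ∸ m)) f                         ≈⟨ ∑-split m (n ∸ m) f ⟩
    ∑ m f + ∑ (n ∸ m) (λ k → f (m ℕ.+ k))       ≈⟨ +-congˡ (∑-zero (n ∸ m) (λ k _ → f≈0 (m ℕ.+ k) (ℕₚ.m≤m+n m k))) ⟩
    ∑ m f + 0#                                  ≈⟨ +-identityʳ _ ⟩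
    ∑ m f                                       ∎

  -- Serves to trade the truncation bound for the natural bound of a binomial sum when neither is
  -- known to be the larger one.
  ∑-support : ∀ {m n} {f : ℕ → Carrier} → (∀ k → m ≤ k → f k ≈ 0#) → (∀ k → n ≤ k → f k ≈ 0#) →
              ∑ m f ≈ ∑ n f
  ∑-support {m} {n} m-zero n-zero with ℕₚ.≤-total m n
  ... | inj₁ m≤n = sym (∑-extend m-zero m≤n)
  ... | inj₂ n≤m = ∑-extend n-zero n≤m

-- q-Pochhammer symbols, q-Chu-Vandermonde and the Jacobi triple product, for any base.

module QSeries {c ℓ} (R : CommutativeRing c ℓ) (q : CommutativeRing.Carrier R) where
  open CommutativeRing R renaming (zero to *-zero)
  open IntegerSolver R
  open FiniteSums R
  open import Algebra.Properties.Semiring.Exp semiring public using (_^_; ^-homo-*)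
  open import Relation.Binary.Reasoning.Setoid setoid

  poch : Carrier → ℕ → Carrier
  poch z zero    = 1#
  poch z (suc n) = poch z n * (1# - z * q ^ n)

  Reciprocal : (ℕ → Carrier) → Set ℓ
  Reciprocal r = ∀ k → r k * poch q k ≈ 1#

  VanishesAfter : ℕ → Set ℓ
  VanishesAfter n = ∀ k → n < k → q ^ k ≈ 0#

  poch-cong : ∀ {x y} n → x ≈ y → poch x n ≈ poch y n
  poch-cong zero    x≈y = refl
  poch-cong (suc n) x≈y = *-cong (poch-cong n x≈y) (+-congˡ (-‿cong (*-congʳ x≈y)))

  poch-split : ∀ z m n → poch z (m ℕ.+ n) ≈ poch z m * poch (z * q ^ m) n
  poch-split z m zero rewrite ℕₚ.+-identityʳ m = sym (*-identityʳ _)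
  poch-split z m (suc n) rewrite ℕₚ.+-suc m n = begin
    poch z (m ℕ.+ n) * (1# - z * q ^ (m ℕ.+ n))
      ≈⟨ *-cong (poch-split z m n) (+-congˡ (-‿cong (trans (*-congˡ (^-homo-* q m n)) (sym (*-assoc _ _ _))))) ⟩
    poch z m * poch (z * q ^ m) n * (1# - z * q ^ m * q ^ n)
      ≈⟨ *-assoc _ _ _ ⟩
    poch z m * (poch (z * q ^ m) n * (1# - z * q ^ m * q ^ n)) ∎

  poch-first : ∀ z n → poch z (suc n) ≈ (1# - z) * poch (z * q) n
  poch-first z n = begin
    poch z (1 ℕ.+ n)                             ≈⟨ poch-split z 1 n ⟩
    1# * (1# - z * 1#) * poch (z * (q * 1#)) n   ≈⟨ *-cong (solve 1 (λ z → :1 :* (:1 :- z :* :1) := :1 :- z) refl z)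
                                                           (poch-cong n (*-congˡ (*-identityʳ q))) ⟩
    (1# - z) * poch (z * q) n                    ∎

  poch-zero : ∀ {z} n → z ≈ 0# → poch z n ≈ 1#
  poch-zero zero    z≈0 = refl
  poch-zero (suc n) z≈0 = trans
    (*-cong (poch-zero n z≈0) (+-congˡ (-‿cong (*-congʳ z≈0))))
    (solve 1 (λ x → :1 :* (:1 :- con (+ 0) :* x) := :1) refl _)

  poch-stable : ∀ {z n} → (∀ k → n ≤ k → z * q ^ k ≈ 0#) → ∀ {k} → n ≤ k → poch z k ≈ poch z n
  poch-stable {z} {n} vanish {k} n≤k = begin
    poch z k                                    ≡⟨ ≡.cong (poch z) (ℕₚ.m+[n∸m]≡n n≤k) ⟨
    poch z (n ℕ.+ (k ∸ n))                      ≈⟨ poch-split z n (k ∸ n) ⟩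
    poch z n * poch (z * q ^ n) (k ∸ n)         ≈⟨ *-congˡ (poch-zero (k ∸ n) (vanish n ℕₚ.≤-refl)) ⟩
    poch z n * 1#                               ≈⟨ *-identityʳ _ ⟩
    poch z n                                    ∎

  -- Pascal's recurrence instead of the quotient, so that no reciprocals are needed;
  -- `gauss-factorial` recovers the quotient.
  gauss : ℕ → ℕ → Carrier
  gauss M       zero    = 1#
  gauss zero    (suc k) = 0#
  gauss (suc M) (suc k) = q ^ suc k * gauss M (suc k) + gauss M k

  gauss-large : ∀ {M k} → M < k → gauss M k ≈ 0#
  gauss-large {zero}  {suc k} _         = refl
  gauss-large {suc M} {suc k} (s≤s M<k) = begin
    q ^ suc k * gauss M (suc k) + gauss M k  ≈⟨ +-cong (*-congˡ (gauss-large (ℕₚ.m<n⇒m<1+n M<k))) (gauss-large M<k) ⟩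
    q ^ suc k * 0# + 0#                      ≈⟨ +-identityʳ _ ⟩
    q ^ suc k * 0#                           ≈⟨ zeroʳ _ ⟩
    0#                                       ∎

  gauss-full : ∀ M → gauss M M ≈ 1#
  gauss-full zero    = refl
  gauss-full (suc M) = begin
    q ^ suc M * gauss M (suc M) + gauss M M  ≈⟨ +-cong (*-congˡ (gauss-large (ℕₚ.n<1+n M))) (gauss-full M) ⟩
    q ^ suc M * 0# + 1#                      ≈⟨ +-congʳ (zeroʳ _) ⟩
    0# + 1#                                  ≈⟨ +-identityˡ _ ⟩
    1#                                       ∎

  -- The two terms of Pascal's rule contribute q^(i+1) (1 - q^(k+1)) and 1 - q^(i+1), which add up
  -- to the new factor 1 - q^(i+k+2).
  gauss-factorial : ∀ i k → gauss (i ℕ.+ k) i * (poch q i * poch q k) ≈ poch q (i ℕ.+ k)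
  gauss-factorial zero    k    = trans (*-identityˡ _) (*-identityˡ _)
  gauss-factorial (suc i) zero rewrite ℕₚ.+-identityʳ i =
    trans (*-cong (gauss-full (suc i)) (*-identityʳ _)) (*-identityˡ _)
  gauss-factorial (suc i) (suc k) = begin
    (q ^ suc i * gauss (i ℕ.+ suc k) (suc i) + gauss (i ℕ.+ suc k) i) * (poch q i * (1# - q * q ^ i) * (poch q k * (1# - q * q ^ k)))
      ≈⟨ solve 7 (λ q x y g g′ a b →
           (q :* x :* g :+ g′) :* (a :* (:1 :- q :* x) :* (b :* (:1 :- q :* y)))
           := q :* x :* (:1 :- q :* y) :* (g :* (a :* (:1 :- q :* x) :* b))
              :+ (:1 :- q :* x) :* (g′ :* (a :* (b :* (:1 :- q :* y))))) refl
         q (q ^ i) (q ^ k) _ _ _ _ ⟩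
    q * q ^ i * (1# - q * q ^ k) * (gauss (i ℕ.+ suc k) (suc i) * (poch q (suc i) * poch q k))
      + (1# - q * q ^ i) * (gauss (i ℕ.+ suc k) i * (poch q i * poch q (suc k)))
      ≈⟨ +-cong (*-congˡ first) (*-congˡ (gauss-factorial i (suc k))) ⟩
    q * q ^ i * (1# - q * q ^ k) * poch q (i ℕ.+ suc k) + (1# - q * q ^ i) * poch q (i ℕ.+ suc k)
      ≈⟨ solve 4 (λ q x y p → q :* x :* (:1 :- q :* y) :* p :+ (:1 :- q :* x) :* p
                             := p :* (:1 :- q :* (x :* (q :* y)))) refl q (q ^ i) (q ^ k) _ ⟩
    poch q (i ℕ.+ suc k) * (1# - q * (q ^ i * q ^ suc k))
      ≈⟨ *-congˡ (+-congˡ (-‿cong (*-congˡ (^-homo-* q i (suc k))))) ⟨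
    poch q (suc (i ℕ.+ suc k)) ∎
    where
    first : gauss (i ℕ.+ suc k) (suc i) * (poch q (suc i) * poch q k) ≈ poch q (i ℕ.+ suc k)
    first rewrite ℕₚ.+-suc i k = gauss-factorial (suc i) k

  -- (-b)ᵗ q^(t choose 2)
  wt : Carrier → ℕ → Carrier
  wt b zero    = 1#
  wt b (suc t) = wt b t * - (b * q ^ t)

  wt-shift : ∀ b t → q ^ t * wt b t ≈ wt (b * q) t
  wt-shift b zero    = *-identityˡ 1#
  wt-shift b (suc t) = begin
    q * q ^ t * (wt b t * - (b * q ^ t))
      ≈⟨ solve 4 (λ q x w b → q :* x :* (w :* :- (b :* x)) := (x :* w) :* :- (b :* q :* x)) refl q (q ^ t) _ b ⟩
    (q ^ t * wt b t) * - (b * q * q ^ t)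
      ≈⟨ *-congʳ (wt-shift b t) ⟩
    wt (b * q) t * - (b * q * q ^ t) ∎

  wt-first : ∀ b t → wt b (suc t) ≈ - b * wt (b * q) t
  wt-first b t = begin
    wt b t * - (b * q ^ t)      ≈⟨ solve 3 (λ w b x → w :* :- (b :* x) := :- b :* (x :* w)) refl _ b (q ^ t) ⟩
    - b * (q ^ t * wt b t)      ≈⟨ *-congˡ (wt-shift b t) ⟩
    - b * wt (b * q) t          ∎

  -- The common engine of the inductions for `q-Chu-Vandermonde` and `finite-jtp`: after it, each
  -- only needs a two-term identity for its own weight h.
  pascal-∑ : ∀ M (h : ℕ → Carrier) →
             ∑ (suc (suc M)) (λ t → gauss (suc M) t * h t)
             ≈ ∑ (suc M) (λ t → gauss M t * (q ^ t * h t + h (suc t)))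
  pascal-∑ M h = begin
    ∑ (suc (suc M)) (λ t → gauss (suc M) t * h t)
      ≈⟨ ∑-first (suc M) _ ⟩
    1# * h 0 + ∑ (suc M) (λ t → (q ^ suc t * gauss M (suc t) + gauss M t) * h (suc t))
      ≈⟨ +-congˡ (trans (∑-cong (suc M) (λ t _ → solve 4 (λ x g g′ h → (x :* g :+ g′) :* h := x :* (g :* h) :+ g′ :* h) refl (q ^ suc t) _ _ _))
                        (∑-distrib-+ (suc M) _ _)) ⟩
    1# * h 0 + (∑ (suc M) (λ t → q ^ suc t * (gauss M (suc t) * h (suc t))) + ∑ (suc M) (λ t → gauss M t * h (suc t)))
      -- Both q ^ 0 and `gauss M 0` are 1, so the loose term becomes t = 0 of the first sum, whose
      -- last term, t = M + 1, is then dropped as zero.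
      ≈⟨ solve 3 (λ h a b → :1 :* h :+ (a :+ b) := (:1 :* (:1 :* h) :+ a) :+ b) refl _ _ _ ⟩
    (1# * (1# * h 0) + ∑ (suc M) (λ t → q ^ suc t * (gauss M (suc t) * h (suc t)))) + ∑ (suc M) (λ t → gauss M t * h (suc t))
      ≈⟨ +-congʳ (∑-first (suc M) (λ t → q ^ t * (gauss M t * h t))) ⟨
    ∑ (suc (suc M)) (λ t → q ^ t * (gauss M t * h t)) + ∑ (suc M) (λ t → gauss M t * h (suc t))
      ≈⟨ +-congʳ (∑-extend (λ t M<t → trans (*-congˡ (trans (*-congʳ (gauss-large M<t)) (zeroˡ _))) (zeroʳ _)) (ℕₚ.n≤1+n (suc M))) ⟩
    ∑ (suc M) (λ t → q ^ t * (gauss M t * h t)) + ∑ (suc M) (λ t → gauss M t * h (suc t))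
      ≈⟨ ∑-distrib-+ (suc M) _ _ ⟨
    ∑ (suc M) (λ t → q ^ t * (gauss M t * h t) + gauss M t * h (suc t))
      ≈⟨ ∑-cong (suc M) (λ t _ → solve 4 (λ x g h h′ → x :* (g :* h) :+ g :* h′ := g :* (x :* h :+ h′)) refl (q ^ t) _ _ _) ⟩
    ∑ (suc M) (λ t → gauss M t * (q ^ t * h t + h (suc t))) ∎

  -- Pascal's rule turns the sum for (M + 1, b) into (1 - b) times the sum for (M, bq).
  q-Chu-Vandermonde : ∀ M a b →
    ∑ (suc M) (λ t → gauss M t * (wt b t * poch a t * poch (a * b * q ^ t) (M ∸ t))) ≈ poch b M
  q-Chu-Vandermonde zero a b = trans (∑-first 0 _) (trans (+-congˡ (∑-empty _))
    (solve 0 (:1 :* (:1 :* :1 :* :1) :+ con (+ 0) := :1) refl))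
  q-Chu-Vandermonde (suc M) a b = begin
    ∑ (suc (suc M)) (λ t → gauss (suc M) t * h t)
      ≈⟨ pascal-∑ M h ⟩
    ∑ (suc M) (λ t → gauss M t * (q ^ t * h t + h (suc t)))
      ≈⟨ ∑-cong (suc M) (λ t t<sM → trans (*-congˡ (term t (ℕ.s≤s⁻¹ t<sM))) (solve 3 (λ g y h → g :* (y :* h) := y :* (g :* h)) refl _ _ _)) ⟩
    ∑ (suc M) (λ t → (1# - b) * (gauss M t * (wt (b * q) t * poch a t * poch (a * (b * q) * q ^ t) (M ∸ t))))
      ≈⟨ *-distribˡ-∑ _ (suc M) _ ⟨
    (1# - b) * ∑ (suc M) (λ t → gauss M t * (wt (b * q) t * poch a t * poch (a * (b * q) * q ^ t) (M ∸ t)))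
      ≈⟨ *-congˡ (q-Chu-Vandermonde M a (b * q)) ⟩
    (1# - b) * poch (b * q) M
      ≈⟨ poch-first b M ⟨
    poch b (suc M) ∎
    where
    h : ℕ → Carrier
    h t = wt b t * poch a t * poch (a * b * q ^ t) (suc M ∸ t)
    term : ∀ t → t ≤ M → q ^ t * h t + h (suc t)
                        ≈ (1# - b) * (wt (b * q) t * poch a t * poch (a * (b * q) * q ^ t) (M ∸ t))
    term t t≤M rewrite ℕₚ.+-∸-assoc 1 t≤M = begin
      q ^ t * (wt b t * poch a t * poch (a * b * q ^ t) (suc (M ∸ t)))
        + wt b (suc t) * (poch a t * (1# - a * q ^ t)) * poch (a * b * (q * q ^ t)) (M ∸ t)
        ≈⟨ +-cong (*-congˡ (*-congˡ (trans (poch-first _ (M ∸ t)) (*-congˡ (poch-cong (M ∸ t)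
                    (solve 4 (λ a b x q → a :* b :* x :* q := a :* (b :* q) :* x) refl a b (q ^ t) q))))))
                  (*-cong (*-congʳ (wt-first b t)) (poch-cong (M ∸ t)
                    (solve 4 (λ a b x q → a :* b :* (q :* x) := a :* (b :* q) :* x) refl a b (q ^ t) q))) ⟩
      q ^ t * (wt b t * poch a t * ((1# - a * b * q ^ t) * P))
        + - b * wt (b * q) t * (poch a t * (1# - a * q ^ t)) * P
        ≈⟨ +-congʳ (solve 5 (λ x w p y P → x :* (w :* p :* (y :* P)) := x :* w :* p :* (y :* P)) refl (q ^ t) _ _ _ _) ⟩
      q ^ t * wt b t * poch a t * ((1# - a * b * q ^ t) * P)
        + - b * wt (b * q) t * (poch a t * (1# - a * q ^ t)) * P
        ≈⟨ +-congʳ (*-congʳ (*-congʳ (wt-shift b t))) ⟩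
      wt (b * q) t * poch a t * ((1# - a * b * q ^ t) * P)
        + - b * wt (b * q) t * (poch a t * (1# - a * q ^ t)) * P
        -- (1 - a b q^t) - b (1 - a q^t) = 1 - b does not depend on t.
        ≈⟨ solve 6 (λ w p a b x P →
             w :* p :* ((:1 :- a :* b :* x) :* P) :+ :- b :* w :* (p :* (:1 :- a :* x)) :* P
             := (:1 :- b) :* (w :* p :* P)) refl _ _ a b (q ^ t) P ⟩
      (1# - b) * (wt (b * q) t * poch a t * P) ∎
      where
      P = poch (a * (b * q) * q ^ t) (M ∸ t)

  -- The case a = 0 of `q-Chu-Vandermonde`, where both inner Pochhammer symbols become 1.
  q-binomial : ∀ M z → ∑ (suc M) (λ t → gauss M t * wt z t) ≈ poch z M
  q-binomial M z = trans
    (∑-cong (suc M) (λ t _ → *-congˡ (sym (trans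
      (*-cong (trans (*-congˡ (poch-zero t refl)) (*-identityʳ _))
              (poch-zero (M ∸ t) (trans (*-congʳ (zeroˡ z)) (zeroˡ _))))
      (*-identityʳ _)))))
    (q-Chu-Vandermonde M 0# z)

  -- The element w stands for q/z, so z need not be invertible: formally (-z)^(-i) q^(i(i+1)/2) =
  -- (-w)^i q^(i(i-1)/2).
  module JacobiTripleProduct (z w : Carrier) (zw≈q : z * w ≈ q) where

    -- The coefficient of the bilateral theta series at index k − K.
    θ : ℕ → ℕ → Carrier
    θ zero    k       = wt z k
    θ (suc K) zero    = wt w (suc K)
    θ (suc K) (suc k) = θ K k

    θ-above : ∀ K j → θ K (K ℕ.+ j) ≡ wt z j
    θ-above zero    j = ≡.refl
    θ-above (suc K) j = θ-above K j

    θ-below : ∀ i j → θ (i ℕ.+ suc j) i ≡ wt w (suc j)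
    θ-below zero    j = ≡.refl
    θ-below (suc i) j = θ-below i j

    -- Moving the centre of the series costs a factor independent of k once q^k is supplied, which
    -- is what `pascal-∑` does. The relation zw = q enters only above the centre, k > K.
    θ-step : ∀ K k → q ^ k * θ (suc K) k ≈ - (w * q ^ K) * θ K k
    θ-step zero zero    = solve 1 (λ w → :1 :* (:1 :* :- (w :* :1)) := :- (w :* :1) :* :1) refl w
    θ-step zero (suc k) = begin
      q * q ^ k * wt z k           ≈⟨ *-congʳ (*-congʳ zw≈q) ⟨
      z * w * q ^ k * wt z k       ≈⟨ solve 4 (λ z w x p → z :* w :* x :* p := :- (w :* :1) :* (p :* :- (z :* x))) refl z w (q ^ k) _ ⟩
      - (w * 1#) * (wt z k * - (z * q ^ k)) ∎
    θ-step (suc K) zero    = trans (*-identityˡ _) (*-comm _ _)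
    θ-step (suc K) (suc k) = begin
      q * q ^ k * θ (suc K) k          ≈⟨ *-assoc _ _ _ ⟩
      q * (q ^ k * θ (suc K) k)        ≈⟨ *-congˡ (θ-step K k) ⟩
      q * (- (w * q ^ K) * θ K k)      ≈⟨ solve 4 (λ q w x p → q :* (:- (w :* x) :* p) := :- (w :* (q :* x)) :* p) refl q w (q ^ K) _ ⟩
      - (w * (q * q ^ K)) * θ K k      ∎

    -- Induction on K from the q-binomial theorem; by `θ-step` each step pulls out 1 - w q^K.
    finite-jtp : ∀ K L → ∑ (suc (K ℕ.+ L)) (λ k → gauss (K ℕ.+ L) k * θ K k) ≈ poch z L * poch w K
    finite-jtp zero    L = trans (q-binomial L z) (sym (*-identityʳ _))
    finite-jtp (suc K) L = begin
      ∑ (suc (suc M)) (λ k → gauss (suc M) k * θ (suc K) k)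
        ≈⟨ pascal-∑ M (θ (suc K)) ⟩
      ∑ (suc M) (λ k → gauss M k * (q ^ k * θ (suc K) k + θ K k))
        ≈⟨ ∑-cong (suc M) (λ k _ → trans (*-congˡ (+-congʳ (θ-step K k)))
             (solve 3 (λ g y p → g :* (:- y :* p :+ p) := (:1 :- y) :* (g :* p)) refl _ _ _)) ⟩
      ∑ (suc M) (λ k → (1# - w * q ^ K) * (gauss M k * θ K k))
        ≈⟨ *-distribˡ-∑ _ (suc M) _ ⟨
      (1# - w * q ^ K) * ∑ (suc M) (λ k → gauss M k * θ K k)
        ≈⟨ *-congˡ (finite-jtp K L) ⟩
      (1# - w * q ^ K) * (poch z L * poch w K)
        ≈⟨ solve 3 (λ y a b → y :* (a :* b) := a :* (b :* y)) refl _ _ _ ⟩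
      poch z L * poch w (suc K) ∎
      where M = K ℕ.+ L

    -- Row 2N + 1 has 2N + 2 entries, so the centre K = N + 1 splits it into equal halves and pairs
    -- the index j with -j-1. Bailey pairs relative to q fold the bilateral index in the same way.
    paired-jtp : ∀ N → ∑ (suc N) (λ j → gauss (suc N ℕ.+ N) (suc N ℕ.+ j) * wt z j
                                       + gauss (suc N ℕ.+ N) (N ∸ j) * wt w (suc j))
                       ≈ poch z N * poch w (suc N)
    paired-jtp N = begin
      ∑ (suc N) (λ j → gauss M (suc N ℕ.+ j) * wt z j + gauss M (N ∸ j) * wt w (suc j))
        ≈⟨ ∑-cong (suc N) (λ j j<sN → +-cong (*-congˡ (reflexive (≡.sym (θ-above (suc N) j))))
                                             (*-congˡ (reflexive (≡.sym (below j (ℕ.s≤s⁻¹ j<sN)))))) ⟩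
      ∑ (suc N) (λ j → T (suc N ℕ.+ j) + T (N ∸ j))
        ≈⟨ ∑-distrib-+ (suc N) _ _ ⟩
      ∑ (suc N) (λ j → T (suc N ℕ.+ j)) + ∑ (suc N) (λ j → T (N ∸ j))
        ≈⟨ +-comm _ _ ⟩
      ∑ (suc N) (λ j → T (N ∸ j)) + ∑ (suc N) (λ j → T (suc N ℕ.+ j))
        ≈⟨ +-congʳ (∑-reverse (suc N) T) ⟨
      ∑ (suc N) T + ∑ (suc N) (λ j → T (suc N ℕ.+ j))
        ≈⟨ ∑-split (suc N) (suc N) T ⟨
      ∑ (suc N ℕ.+ suc N) T
        ≡⟨ ≡.cong (λ k → ∑ (suc k) T) (ℕₚ.+-suc N N) ⟩
      ∑ (suc M) T
        ≈⟨ finite-jtp (suc N) N ⟩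
      poch z N * poch w (suc N) ∎
      where
      M = suc N ℕ.+ N
      T : ℕ → Carrier
      T k = gauss M k * θ (suc N) k
      below : ∀ j → j ≤ N → θ (suc N) (N ∸ j) ≡ wt w (suc j)
      below j j≤N = ≡.trans
        (≡.cong (λ K → θ K (N ∸ j)) (≡.trans (≡.cong suc (≡.sym (ℕₚ.m∸n+n≡m j≤N))) (≡.sym (ℕₚ.+-suc (N ∸ j) j))))
        (θ-below (N ∸ j) j)

    -- With N = 2n, the lower indices N + 1 + j and N - j are both at least n for j ≤ n, so (q)_n
    -- times each Gaussian binomial is 1; for j > n the weights vanish.
    truncated-jtp : ∀ {n u} → (∀ k → n ≤ k → z * q ^ k ≈ 0#) → (∀ k → n ≤ k → w * q ^ k ≈ 0#) →
                    (∀ k → n ≤ k → q * q ^ k ≈ 0#) → u * poch q n ≈ 1# →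
                    poch q n * (poch z n * poch w n) ≈ ∑ (suc (n ℕ.+ n)) (λ j → wt z j + wt w (suc j))
    truncated-jtp {n} {u} z-vanish w-vanish q-vanish unit = begin
      P * (poch z n * poch w n)
        ≈⟨ *-congˡ (*-cong (poch-stable z-vanish (ℕₚ.m≤m+n n n)) (poch-stable w-vanish (ℕₚ.m≤n⇒m≤1+n (ℕₚ.m≤m+n n n)))) ⟨
      P * (poch z N * poch w (suc N))
        ≈⟨ *-congˡ (paired-jtp N) ⟨
      P * ∑ (suc N) (λ j → gauss M (suc N ℕ.+ j) * wt z j + gauss M (N ∸ j) * wt w (suc j))
        ≈⟨ *-distribˡ-∑ P (suc N) _ ⟩
      ∑ (suc N) (λ j → P * (gauss M (suc N ℕ.+ j) * wt z j + gauss M (N ∸ j) * wt w (suc j)))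
        ≈⟨ ∑-cong (suc N) (λ j j<sN → term j (ℕ.s≤s⁻¹ j<sN)) ⟩
      ∑ (suc N) (λ j → wt z j + wt w (suc j)) ∎
      where
      P = poch q n
      N = n ℕ.+ n
      M = suc N ℕ.+ N
      gauss-limit : ∀ {i k} → n ≤ i → n ≤ k → P * gauss (i ℕ.+ k) i ≈ 1#
      gauss-limit {i} {k} n≤i n≤k = begin
        P * g                              ≈⟨ *-identityˡ _ ⟨
        1# * (P * g)                       ≈⟨ *-congʳ unit ⟨
        u * P * (P * g)                    ≈⟨ solve 3 (λ u P g → u :* P :* (P :* g) := u :* (g :* (P :* P))) refl _ _ _ ⟩
        u * (g * (P * P))                  ≈⟨ *-congˡ (*-congˡ (*-cong (poch-stable q-vanish n≤i) (poch-stable q-vanish n≤k))) ⟨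
        u * (g * (poch q i * poch q k))    ≈⟨ *-congˡ (gauss-factorial i k) ⟩
        u * poch q (i ℕ.+ k)               ≈⟨ *-congˡ (poch-stable q-vanish (ℕₚ.≤-trans n≤i (ℕₚ.m≤m+n i k))) ⟩
        u * P                              ≈⟨ unit ⟩
        1#                                 ∎
        where g = gauss (i ℕ.+ k) i
      wt-vanish : ∀ {x} → (∀ k → n ≤ k → x * q ^ k ≈ 0#) → ∀ {j} → n < j → wt x j ≈ 0#
      wt-vanish {x} x-vanish {suc j} (s≤s n≤j) = begin
        wt x j * - (x * q ^ j)             ≈⟨ *-congˡ (-‿cong (x-vanish j n≤j)) ⟩
        wt x j * - 0#                      ≈⟨ solve 1 (λ w → w :* :- con (+ 0) := con (+ 0)) refl _ ⟩
        0#                                 ∎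
      absorb : ∀ {g x} → P * g ≈ 1# → P * (g * x) ≈ x
      absorb Pg≈1 = trans (sym (*-assoc _ _ _)) (trans (*-congʳ Pg≈1) (*-identityˡ _))
      kill : ∀ {g x} → x ≈ 0# → P * (g * x) ≈ x
      kill x≈0 = trans (*-congˡ (trans (*-congˡ x≈0) (zeroʳ _))) (trans (zeroʳ _) (sym x≈0))
      term : ∀ j → j ≤ N → P * (gauss M (suc N ℕ.+ j) * wt z j + gauss M (N ∸ j) * wt w (suc j)) ≈ wt z j + wt w (suc j)
      term j j≤N with j ℕₚ.≤? n
      ... | no  j≰n = trans (distribˡ _ _ _)
                        (+-cong (kill (wt-vanish z-vanish (ℕₚ.≰⇒> j≰n)))
                                (kill (wt-vanish w-vanish (ℕₚ.m<n⇒m<1+n (ℕₚ.≰⇒> j≰n)))))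
      ... | yes j≤n = trans (distribˡ _ _ _) (+-cong (absorb upper) (absorb lower))
        where
        n≤N∸j : n ≤ N ∸ j
        n≤N∸j = ℕₚ.≤-trans (ℕₚ.≤-reflexive (≡.sym (ℕₚ.m+n∸n≡m n j))) (ℕₚ.∸-monoˡ-≤ j (ℕₚ.+-monoʳ-≤ n j≤n))
        n≤N+j : n ≤ suc N ℕ.+ j
        n≤N+j = ℕₚ.m≤n⇒m≤1+n (ℕₚ.≤-trans (ℕₚ.m≤m+n n n) (ℕₚ.m≤m+n N j))
        M≡ : suc N ℕ.+ j ℕ.+ (N ∸ j) ≡ M
        M≡ = ≡.trans (ℕₚ.+-assoc (suc N) j (N ∸ j)) (≡.cong (suc N ℕ.+_) (ℕₚ.m+[n∸m]≡n j≤N))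
        upper : P * gauss M (suc N ℕ.+ j) ≈ 1#
        upper = ≡.subst (λ k → P * gauss k (suc N ℕ.+ j) ≈ 1#) M≡ (gauss-limit n≤N+j n≤N∸j)
        lower : P * gauss M (N ∸ j) ≈ 1#
        lower = ≡.subst (λ k → P * gauss k (N ∸ j) ≈ 1#) (≡.trans (ℕₚ.+-comm (N ∸ j) _) M≡) (gauss-limit n≤N∸j n≤N+j)

-- Bailey's lemma relative to q.

module Bailey {c ℓ} (R : CommutativeRing c ℓ) (q : CommutativeRing.Carrier R)
  (r : ℕ → CommutativeRing.Carrier R)
  (r-inverse : QSeries.Reciprocal R q r) where
  open CommutativeRing R renaming (zero to *-zero)
  open IntegerSolver R
  open FiniteSums R
  open QSeries R q
  open import Relation.Binary.Reasoning.Setoid setoid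

  cancelˡ : ∀ {u v x y} → u * v ≈ 1# → v * x ≈ v * y → x ≈ y
  cancelˡ {u} {v} {x} {y} uv≈1 vx≈vy = begin
    x            ≈⟨ *-identityˡ x ⟨
    1# * x       ≈⟨ *-congʳ uv≈1 ⟨
    u * v * x    ≈⟨ *-assoc u v x ⟩
    u * (v * x)  ≈⟨ *-congˡ vx≈vy ⟩
    u * (v * y)  ≈⟨ *-assoc u v y ⟨
    u * v * y    ≈⟨ *-congʳ uv≈1 ⟩
    1# * y       ≈⟨ *-identityˡ y ⟩
    y            ∎

  r-step : ∀ k → r k ≈ (1# - q ^ suc k) * r (suc k)
  r-step k = cancelˡ (r-inverse (suc k)) (begin
    poch q k * (1# - q * q ^ k) * r k                 ≈⟨ solve 3 (λ p y r → p :* y :* r := (r :* p) :* y) refl _ _ _ ⟩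
    (r k * poch q k) * (1# - q * q ^ k)               ≈⟨ *-congʳ (r-inverse k) ⟩
    1# * (1# - q * q ^ k)                             ≈⟨ *-congʳ (r-inverse (suc k)) ⟨
    r (suc k) * poch q (suc k) * (1# - q * q ^ k)     ≈⟨ solve 3 (λ p y r → r :* p :* y := p :* (y :* r)) refl _ _ _ ⟩
    poch q (suc k) * ((1# - q ^ suc k) * r (suc k))   ∎)

  -- 1 / (q)_(n−j), read as 0 when j > n
  rs : ℕ → ℕ → Carrier
  rs n       zero    = r n
  rs zero    (suc j) = 0#
  rs (suc n) (suc j) = rs n j

  rs-large : ∀ {n j} → n < j → rs n j ≈ 0#
  rs-large {zero}  {suc j} _         = refl
  rs-large {suc n} {suc j} (s≤s n<j) = rs-large n<j

  rs-shift : ∀ j n i → rs (j ℕ.+ n) (j ℕ.+ i) ≡ rs n i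
  rs-shift zero    n i = ≡.refl
  rs-shift (suc j) n i = rs-shift j n i

  rs-+ : ∀ j n → rs (j ℕ.+ n) j ≡ r n
  rs-+ zero    n = ≡.refl
  rs-+ (suc j) n = rs-+ j n

  rs-step : ∀ n j → rs n (suc j) ≈ (1# - q ^ (n ∸ j)) * rs n j
  rs-step zero    zero    = solve 1 (λ x → con (+ 0) := (:1 :- :1) :* x) refl _
  rs-step zero    (suc j) = sym (zeroʳ _)
  rs-step (suc n) zero    = r-step n
  rs-step (suc n) (suc j) = rs-step n j

  -- The factor `rs n j` makes this true for j > n as well, where truncated subtraction spoils the
  -- exponents.
  rs-power : ∀ n j → q ^ (n ∸ j) * q ^ j * rs n j ≈ q ^ n * rs n j
  rs-power n       zero    = *-congʳ (*-identityʳ _)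
  rs-power zero    (suc j) = trans (zeroʳ _) (sym (zeroʳ _))
  rs-power (suc n) (suc j) = begin
    q ^ (n ∸ j) * (q * q ^ j) * rs n j     ≈⟨ solve 4 (λ d q x p → d :* (q :* x) :* p := q :* (d :* x :* p)) refl _ _ _ _ ⟩
    q * (q ^ (n ∸ j) * q ^ j * rs n j)     ≈⟨ *-congˡ (rs-power n j) ⟩
    q * (q ^ n * rs n j)                   ≈⟨ *-assoc _ _ _ ⟨
    q * q ^ n * rs n j                     ∎

  rs-step-power : ∀ n j → q ^ j * rs n (suc j) ≈ (q ^ j - q ^ n) * rs n j
  rs-step-power n j = begin
    q ^ j * rs n (suc j)                               ≈⟨ *-congˡ (rs-step n j) ⟩
    q ^ j * ((1# - q ^ (n ∸ j)) * rs n j)              ≈⟨ solve 3 (λ x d p → x :* ((:1 :- d) :* p) := x :* p :- d :* x :* p) refl _ _ _ ⟩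
    q ^ j * rs n j - q ^ (n ∸ j) * q ^ j * rs n j      ≈⟨ +-congˡ (-‿cong (rs-power n j)) ⟩
    q ^ j * rs n j - q ^ n * rs n j                    ≈⟨ solve 3 (λ x y p → x :* p :- y :* p := (x :- y) :* p) refl _ _ _ ⟩
    (q ^ j - q ^ n) * rs n j                           ∎

  -- tri j = q^(j(j+1)/2), bin j = q^(j(j-1)/2)
  tri : ℕ → Carrier
  tri zero    = 1#
  tri (suc j) = tri j * (q * q ^ j)

  bin : ℕ → Carrier
  bin zero    = 1#
  bin (suc j) = tri j

  tri≈bin : ∀ j → tri j ≈ bin j * q ^ j
  tri≈bin zero    = sym (*-identityˡ 1#)
  tri≈bin (suc j) = refl

  sgn : ℕ → Carrier
  sgn j = (- 1#) ^ j

  poch⁻ : ℕ → Carrier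
  poch⁻ = poch (- q)

  -- The usual kernel 1 / ((q)_(x-j) (q²;q)_(x+j)) divided by 1 - q.
  κ : ℕ → ℕ → Carrier
  κ x j = rs x j * r (suc x ℕ.+ j)

  κ-large : ∀ {x j} → x < j → κ x j ≈ 0#
  κ-large x<j = trans (*-congʳ (rs-large x<j)) (zeroˡ _)

  -- (α, F α) is, up to normalisation, a Bailey pair relative to q.
  F : (ℕ → Carrier) → ℕ → Carrier
  F α x = ∑ (suc x) (λ j → α j * κ x j)

  F-cong : ∀ {α β} x → (∀ j → α j ≈ β j) → F α x ≈ F β x
  F-cong x α≈β = ∑-cong (suc x) (λ j _ → *-congʳ (α≈β j))

  F-extend : ∀ α {x m} → x < m → ∑ m (λ j → α j * κ x j) ≈ F α x
  F-extend α x<m = ∑-extend (λ j x<j → trans (*-congˡ (κ-large x<j)) (zeroʳ _)) x<m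

  -- j(j+1)/2 + (j+1)s + s(s-1)/2 = (j+s)(j+s+1)/2, and the sign inside `wt` cancels that of -q.
  tri-wt : ∀ j s → tri j * wt (- q * q ^ j) s ≈ tri (j ℕ.+ s)
  tri-wt j zero rewrite ℕₚ.+-identityʳ j = *-identityʳ _
  tri-wt j (suc s) rewrite ℕₚ.+-suc j s = begin
    tri j * (wt (- q * q ^ j) s * - (- q * q ^ j * q ^ s))
      ≈⟨ solve 5 (λ t w q x y → t :* (w :* :- (:- q :* x :* y)) := t :* w :* (q :* (x :* y))) refl _ _ q (q ^ j) (q ^ s) ⟩
    tri j * wt (- q * q ^ j) s * (q * (q ^ j * q ^ s))
      ≈⟨ *-cong (tri-wt j s) (*-congˡ (sym (^-homo-* q j s))) ⟩
    tri (j ℕ.+ s) * (q * q ^ (j ℕ.+ s)) ∎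

  gauss-r : ∀ s d → gauss (s ℕ.+ d) s * r (s ℕ.+ d) ≈ r d * r s
  gauss-r s d = begin
    g * r (s ℕ.+ d)
      ≈⟨ solve 2 (λ g r → g :* r := g :* r :* (:1 :* :1)) refl _ _ ⟩
    g * r (s ℕ.+ d) * (1# * 1#)
      ≈⟨ *-congˡ (*-cong (r-inverse s) (r-inverse d)) ⟨
    g * r (s ℕ.+ d) * ((r s * poch q s) * (r d * poch q d))
      ≈⟨ solve 6 (λ g r rs ps rd pd → g :* r :* ((rs :* ps) :* (rd :* pd)) := r :* (g :* (ps :* pd)) :* (rd :* rs)) refl _ _ _ _ _ _ ⟩
    r (s ℕ.+ d) * (g * (poch q s * poch q d)) * (r d * r s)
      ≈⟨ *-congʳ (*-congˡ (gauss-factorial s d)) ⟩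
    r (s ℕ.+ d) * poch q (s ℕ.+ d) * (r d * r s)
      ≈⟨ *-congʳ (r-inverse (s ℕ.+ d)) ⟩
    1# * (r d * r s)
      ≈⟨ *-identityˡ _ ⟩
    r d * r s ∎
    where g = gauss (s ℕ.+ d) s

  poch-r : ∀ m d → poch (q * q ^ m) d * r (m ℕ.+ d) ≈ r m
  poch-r m d = cancelˡ (r-inverse m) (begin
    poch q m * (poch (q * q ^ m) d * r (m ℕ.+ d))    ≈⟨ *-assoc _ _ _ ⟨
    poch q m * poch (q * q ^ m) d * r (m ℕ.+ d)      ≈⟨ *-congʳ (poch-split q m d) ⟨
    poch q (m ℕ.+ d) * r (m ℕ.+ d)                   ≈⟨ *-comm _ _ ⟩
    r (m ℕ.+ d) * poch q (m ℕ.+ d)                   ≈⟨ r-inverse (m ℕ.+ d) ⟩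
    1#                                               ≈⟨ r-inverse m ⟨
    r m * poch q m                                   ≈⟨ *-comm _ _ ⟩
    poch q m * r m                                   ∎)

  -- `q-Chu-Vandermonde` with a = b = -q^(j+1). The signs cancel in a b q^s = q^(2j+2+s), so the
  -- remaining Pochhammer symbol is a quotient (q)_(2j+1+M) / (q)_(2j+1+s).
  κ-sum : ∀ j M → ∑ (suc M) (λ s → tri (j ℕ.+ s) * poch⁻ (j ℕ.+ s) * (rs M s * (r s * r (suc (j ℕ.+ s) ℕ.+ j))))
                  ≈ poch⁻ (j ℕ.+ M) * (tri j * (r M * r (suc (j ℕ.+ M) ℕ.+ j)))
  κ-sum j M = begin
    ∑ (suc M) (λ s → tri (j ℕ.+ s) * poch⁻ (j ℕ.+ s) * (rs M s * (r s * r (suc (j ℕ.+ s) ℕ.+ j))))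
      ≈⟨ ∑-cong (suc M) (λ s s<sM → sym (term s (ℕₚ.m≤n⇒∃[o]m+o≡n (ℕ.s≤s⁻¹ s<sM)))) ⟩
    ∑ (suc M) (λ s → A * (gauss M s * (wt b s * poch b s * poch (b * b * q ^ s) (M ∸ s))))
      ≈⟨ *-distribˡ-∑ A (suc M) _ ⟨
    A * ∑ (suc M) (λ s → gauss M s * (wt b s * poch b s * poch (b * b * q ^ s) (M ∸ s)))
      ≈⟨ *-congˡ (q-Chu-Vandermonde M b b) ⟩
    A * poch b M
      ≈⟨ solve 5 (λ p t r r′ b → p :* t :* (r :* r′) :* b := p :* b :* (t :* (r :* r′))) refl _ _ _ _ _ ⟩
    poch⁻ j * poch b M * (tri j * (r M * r (suc (j ℕ.+ M) ℕ.+ j)))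
      ≈⟨ *-congʳ (poch-split (- q) j M) ⟨
    poch⁻ (j ℕ.+ M) * (tri j * (r M * r (suc (j ℕ.+ M) ℕ.+ j))) ∎
    where
    b A : Carrier
    b = - q * q ^ j
    A = poch⁻ j * tri j * (r M * r (suc (j ℕ.+ M) ℕ.+ j))
    index : ∀ s d → suc (j ℕ.+ (s ℕ.+ d)) ℕ.+ j ≡ suc (j ℕ.+ s) ℕ.+ j ℕ.+ d
    index s d = ≡.cong suc (≡.trans (≡.cong (ℕ._+ j) (≡.sym (ℕₚ.+-assoc j s d)))
                  (≡.trans (ℕₚ.+-assoc (j ℕ.+ s) d j)
                    (≡.trans (≡.cong (j ℕ.+ s ℕ.+_) (ℕₚ.+-comm d j)) (≡.sym (ℕₚ.+-assoc (j ℕ.+ s) j d)))))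
    base : ∀ s → b * b * q ^ s ≈ q * q ^ (suc (j ℕ.+ s) ℕ.+ j)
    base s = begin
      - q * q ^ j * (- q * q ^ j) * q ^ s
        ≈⟨ solve 3 (λ q x y → :- q :* x :* (:- q :* x) :* y := q :* (q :* (x :* y :* x))) refl q (q ^ j) (q ^ s) ⟩
      q * (q * (q ^ j * q ^ s * q ^ j))
        ≈⟨ *-congˡ (*-congˡ (trans (^-homo-* q (j ℕ.+ s) j) (*-congʳ (^-homo-* q j s)))) ⟨
      q * (q * q ^ (j ℕ.+ s ℕ.+ j)) ∎
    term : ∀ s → (∃ λ d → s ℕ.+ d ≡ M) →
      A * (gauss M s * (wt b s * poch b s * poch (b * b * q ^ s) (M ∸ s)))
      ≈ tri (j ℕ.+ s) * poch⁻ (j ℕ.+ s) * (rs M s * (r s * r (suc (j ℕ.+ s) ℕ.+ j)))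
    term s (d , ≡.refl) rewrite ℕₚ.m+n∸m≡n s d | rs-+ s d | index s d = begin
      poch⁻ j * tri j * (r (s ℕ.+ d) * r (k ℕ.+ d)) * (gauss (s ℕ.+ d) s * (wt b s * poch b s * poch (b * b * q ^ s) d))
        ≈⟨ *-congˡ (*-congˡ (*-congˡ (poch-cong d (base s)))) ⟩
      poch⁻ j * tri j * (r (s ℕ.+ d) * r (k ℕ.+ d)) * (gauss (s ℕ.+ d) s * (wt b s * poch b s * poch (q * q ^ k) d))
        ≈⟨ solve 8 (λ p t r r′ g w pb P → p :* t :* (r :* r′) :* (g :* (w :* pb :* P))
             := (t :* w) :* (p :* pb) :* ((g :* r) :* (P :* r′))) refl _ _ _ _ _ _ _ _ ⟩
      (tri j * wt b s) * (poch⁻ j * poch b s) * ((gauss (s ℕ.+ d) s * r (s ℕ.+ d)) * (poch (q * q ^ k) d * r (k ℕ.+ d)))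
        ≈⟨ *-cong (*-cong (tri-wt j s) (sym (poch-split (- q) j s))) (*-cong (gauss-r s d) (poch-r k d)) ⟩
      tri (j ℕ.+ s) * poch⁻ (j ℕ.+ s) * ((r d * r s) * r k)
        ≈⟨ *-congˡ (*-assoc _ _ _) ⟩
      tri (j ℕ.+ s) * poch⁻ (j ℕ.+ s) * (r d * (r s * r k)) ∎
      where k = suc (j ℕ.+ s) ℕ.+ j

  -- Bailey's lemma for an α concentrated at j. The kernel vanishes for s < j, and replacing s by j
  -- + s leads to `κ-sum`.
  κ-transform : ∀ j N → j ≤ N → ∑ (suc N) (λ s → tri s * poch⁻ s * (rs N s * κ s j)) ≈ poch⁻ N * (tri j * κ N j)
  κ-transform j N j≤N = go (ℕₚ.m≤n⇒∃[o]m+o≡n j≤N)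
    where
    go : (∃ λ M → j ℕ.+ M ≡ N) → ∑ (suc N) (λ s → tri s * poch⁻ s * (rs N s * κ s j)) ≈ poch⁻ N * (tri j * κ N j)
    go (M , ≡.refl) = begin
      ∑ (suc (j ℕ.+ M)) f
        ≡⟨ ≡.cong (λ k → ∑ k f) (≡.sym (ℕₚ.+-suc j M)) ⟩
      ∑ (j ℕ.+ suc M) f
        ≈⟨ ∑-split j (suc M) f ⟩
      ∑ j f + ∑ (suc M) (λ s → f (j ℕ.+ s))
        ≈⟨ +-cong (∑-zero j (λ s s<j → trans (*-congˡ (trans (*-congˡ (κ-large s<j)) (zeroʳ _))) (zeroʳ _)))
                  (∑-cong (suc M) (λ s _ → *-congˡ (*-cong (reflexive (rs-shift j M s)) (*-congʳ (reflexive (rs-+ j s)))))) ⟩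
      0# + ∑ (suc M) (λ s → tri (j ℕ.+ s) * poch⁻ (j ℕ.+ s) * (rs M s * (r s * r (suc (j ℕ.+ s) ℕ.+ j))))
        ≈⟨ +-identityˡ _ ⟩
      ∑ (suc M) (λ s → tri (j ℕ.+ s) * poch⁻ (j ℕ.+ s) * (rs M s * (r s * r (suc (j ℕ.+ s) ℕ.+ j))))
        ≈⟨ κ-sum j M ⟩
      poch⁻ (j ℕ.+ M) * (tri j * (r M * r (suc (j ℕ.+ M) ℕ.+ j)))
        ≈⟨ *-congˡ (*-congˡ (*-congʳ (reflexive (rs-+ j M)))) ⟨
      poch⁻ (j ℕ.+ M) * (tri j * κ (j ℕ.+ M) j) ∎
      where
      f : ℕ → Carrier
      f s = tri s * poch⁻ s * (rs (j ℕ.+ M) s * κ s j)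

  -- Bailey's lemma with ρ₁ = -q, ρ₂ → ∞.
  bailey-lemma : ∀ α N → ∑ (suc N) (λ s → tri s * poch⁻ s * (rs N s * F α s)) ≈ poch⁻ N * F (λ j → tri j * α j) N
  bailey-lemma α N = begin
    ∑ (suc N) (λ s → tri s * poch⁻ s * (rs N s * F α s))
      ≈⟨ ∑-cong (suc N) (λ s s<sN → begin
           tri s * poch⁻ s * (rs N s * F α s)
             ≈⟨ *-assoc _ _ _ ⟨
           tri s * poch⁻ s * rs N s * F α s
             ≈⟨ *-congˡ (F-extend α s<sN) ⟨
           tri s * poch⁻ s * rs N s * ∑ (suc N) (λ j → α j * κ s j)
             ≈⟨ *-distribˡ-∑ _ (suc N) _ ⟩
           ∑ (suc N) (λ j → tri s * poch⁻ s * rs N s * (α j * κ s j))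
             ≈⟨ ∑-cong (suc N) (λ j _ → solve 5 (λ t p r a k → t :* p :* r :* (a :* k) := a :* (t :* p :* (r :* k))) refl _ _ _ _ _) ⟩
           ∑ (suc N) (λ j → α j * (tri s * poch⁻ s * (rs N s * κ s j))) ∎) ⟩
    ∑ (suc N) (λ s → ∑ (suc N) (λ j → α j * (tri s * poch⁻ s * (rs N s * κ s j))))
      ≈⟨ ∑-swap (suc N) (suc N) _ ⟩
    ∑ (suc N) (λ j → ∑ (suc N) (λ s → α j * (tri s * poch⁻ s * (rs N s * κ s j))))
      ≈⟨ ∑-cong (suc N) (λ j j<sN → begin
           ∑ (suc N) (λ s → α j * (tri s * poch⁻ s * (rs N s * κ s j)))
             ≈⟨ *-distribˡ-∑ (α j) (suc N) _ ⟨
           α j * ∑ (suc N) (λ s → tri s * poch⁻ s * (rs N s * κ s j))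
             ≈⟨ *-congˡ (κ-transform j N (ℕ.s≤s⁻¹ j<sN)) ⟩
           α j * (poch⁻ N * (tri j * κ N j))
             ≈⟨ solve 4 (λ a p t k → a :* (p :* (t :* k)) := p :* (t :* a :* k)) refl _ _ _ _ ⟩
           poch⁻ N * (tri j * α j * κ N j) ∎) ⟩
    ∑ (suc N) (λ j → poch⁻ N * (tri j * α j * κ N j))
      ≈⟨ *-distribˡ-∑ _ (suc N) _ ⟨
    poch⁻ N * F (λ j → tri j * α j) N ∎

-- The unit Bailey pair, its iterates, and the shift from x to x + 1.

module BaileyPairs {r₁ r₂} (R : CommutativeRing r₁ r₂) (q : CommutativeRing.Carrier R)
  (r : ℕ → CommutativeRing.Carrier R)
  (r-inverse : QSeries.Reciprocal R q r) where
  open CommutativeRing R renaming (zero to *-zero)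
  open IntegerSolver R
  open FiniteSums R
  open QSeries R q
  open Bailey R q r r-inverse
  open import Relation.Binary.Reasoning.Setoid setoid

  1^ : ∀ e → 1# ^ e ≈ 1#
  1^ zero    = refl
  1^ (suc e) = trans (*-identityˡ _) (1^ e)

  r-step-+ : ∀ n j → r (n ℕ.+ j) ≈ (1# - q * (q ^ n * q ^ j)) * r (suc n ℕ.+ j)
  r-step-+ n j = trans (r-step (n ℕ.+ j)) (*-congʳ (+-congˡ (-‿cong (*-congˡ (^-homo-* q n j)))))

  -- The α of the unit Bailey pair relative to q, multiplied by 1 - q to compensate for the
  -- normalisation of `κ`.
  unit : ℕ → Carrier
  unit j = sgn j * (bin j * (1# - q * (q ^ j * q ^ j)))

  F-unit-zero : F unit 0 ≈ 1#
  F-unit-zero = begin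
    F unit 0
      ≈⟨ trans (∑-first 0 _) (+-congˡ (∑-empty _)) ⟩
    1# * (1# * (1# - q * (1# * 1#))) * (r 0 * r 1) + 0#
      ≈⟨ solve 3 (λ q r0 r1 → :1 :* (:1 :* (:1 :- q :* (:1 :* :1))) :* (r0 :* r1) :+ con (+ 0)
           := (r0 :* :1) :* (r1 :* (:1 :* (:1 :- q :* :1)))) refl q (r 0) (r 1) ⟩
    (r 0 * 1#) * (r 1 * (1# * (1# - q * 1#)))
      ≈⟨ *-cong (r-inverse 0) (r-inverse 1) ⟩
    1# * 1#
      ≈⟨ *-identityˡ 1# ⟩
    1# ∎

  -- After multiplication by 1 - q^n, a unit because it divides (q)_n, the summand telescopes as T j
  -- - T (j + 1). Both ends vanish: T 0 through its factor 1 - q^0, and T (n + 1) through 1 /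
  -- (q)_(n-j).
  F-unit-suc : ∀ n → F unit (suc n) ≈ 0#
  F-unit-suc n′ = cancelˡ invertible (begin
    (1# - q ^ n) * F unit n
      ≈⟨ *-distribˡ-∑ _ (suc n) _ ⟩
    ∑ (suc n) (λ j → (1# - q ^ n) * (unit j * κ n j))
      ≈⟨ ∑-cong (suc n) (λ j _ → term j) ⟩
    ∑ (suc n) (λ j → T j - T (suc j))
      ≈⟨ ∑-telescope (suc n) T ⟩
    T 0 - T (suc n)
      ≈⟨ +-cong (solve 2 (λ ρ r → :1 :* (:1 :* (:1 :- :1)) :* (ρ :* r) := con (+ 0)) refl _ _)
                (-‿cong (trans (*-congˡ (trans (*-congʳ (rs-large (ℕₚ.n<1+n n))) (zeroˡ _))) (zeroʳ _))) ⟩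
    0# - 0#
      ≈⟨ solve 1 (λ x → con (+ 0) :- con (+ 0) := x :* con (+ 0)) refl _ ⟩
    (1# - q ^ n) * 0# ∎)
    where
    n = suc n′
    invertible : r n * poch q n′ * (1# - q ^ n) ≈ 1#
    invertible = trans (*-assoc _ _ _) (r-inverse n)
    T : ℕ → Carrier
    T j = sgn j * (bin j * (1# - q ^ j)) * (rs n j * r (n ℕ.+ j))
    term : ∀ j → (1# - q ^ n) * (unit j * κ n j) ≈ T j - T (suc j)
    term j = sym (begin
      T j - T (suc j)
        ≈⟨ +-cong (*-congˡ (*-congˡ (r-step-+ n j)))
                  (-‿cong (*-cong (*-congˡ (*-congʳ (tri≈bin j))) (*-congˡ (reflexive (≡.cong r (ℕₚ.+-suc n j)))))) ⟩
      s * (c * (1# - x)) * (rs n j * ((1# - q * (y * x)) * ρ)) - (- 1# * s) * (c * x * (1# - q * x)) * (rs n (suc j) * ρ)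
        ≈⟨ solve 8 (λ s c x y q ρ R R′ →
             s :* (c :* (:1 :- x)) :* (R :* ((:1 :- q :* (y :* x)) :* ρ)) :- (:- :1 :* s) :* (c :* x :* (:1 :- q :* x)) :* (R′ :* ρ)
             := s :* c :* ρ :* ((:1 :- x) :* (:1 :- q :* (y :* x)) :* R :+ (:1 :- q :* x) :* (x :* R′))) refl s c x y q ρ _ _ ⟩
      s * c * ρ * ((1# - x) * (1# - q * (y * x)) * rs n j + (1# - q * x) * (x * rs n (suc j)))
        ≈⟨ *-congˡ (+-congˡ (*-congˡ (rs-step-power n j))) ⟩
      s * c * ρ * ((1# - x) * (1# - q * (y * x)) * rs n j + (1# - q * x) * ((x - y) * rs n j))
        ≈⟨ solve 7 (λ s c x y q ρ R →
             s :* c :* ρ :* ((:1 :- x) :* (:1 :- q :* (y :* x)) :* R :+ (:1 :- q :* x) :* ((x :- y) :* R))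
             := (:1 :- y) :* (s :* (c :* (:1 :- q :* (x :* x))) :* (R :* ρ))) refl s c x y q ρ _ ⟩
      (1# - y) * (unit j * κ n j) ∎)
      where
      s = sgn j
      c = bin j
      x = q ^ j
      y = q ^ n
      ρ = r (suc n ℕ.+ j)

  -- The α reached after e steps of the chain without Kronecker delta, and its replacement
  -- once the delta has shifted x to x + 1.
  plain shifted : ℕ → ℕ → Carrier
  plain   e j = sgn j * (tri j ^ e * (tri j * bin j - tri (suc j) * tri j))
  shifted e j = sgn j * (bin j ^ e * (tri j * bin j)) - sgn j * (tri (suc j) ^ e * (tri (suc j) * tri j))

  tri-plain : ∀ e j → tri j * plain e j ≈ plain (suc e) j
  tri-plain e j = solve 4 (λ t s p y → t :* (s :* (p :* y)) := s :* (t :* p :* y)) refl _ _ _ _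

  -- Here tri j · bin j = q^(j²) and tri (j+1) · tri j = q^((j+1)²): the two terms of `plain` are
  -- the values at i = j and i = -j-1 of (-1)^i q^(e·i(i+1)/2 + i²).
  tri-unit : ∀ j → tri j * unit j ≈ plain 0 j
  tri-unit j = begin
    tri j * (sgn j * (bin j * (1# - q * (q ^ j * q ^ j))))
      ≈⟨ solve 5 (λ t s b q x → t :* (s :* (b :* (:1 :- q :* (x :* x)))) := s :* (:1 :* (t :* b :- t :* (q :* x) :* (b :* x)))) refl _ _ _ q (q ^ j) ⟩
    sgn j * (1# * (tri j * bin j - tri (suc j) * (bin j * q ^ j)))
      ≈⟨ *-congˡ (*-congˡ (+-congˡ (-‿cong (*-congˡ (tri≈bin j))))) ⟨
    plain 0 j ∎

  -- The prefactors make a Bailey step reproduce its own shape: (q)_s cancels a denominator of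
  -- [N, s] and (-q)_s is the weight in `bailey-lemma`, while (q)_N comes from [N, s] and (-q)_N
  -- from the lemma.
  H : (ℕ → Carrier) → ℕ → Carrier
  H α x = poch q x * poch⁻ x * F α x

  H-cong : ∀ {α β} x → (∀ j → α j ≈ β j) → H α x ≈ H β x
  H-cong x α≈β = *-congˡ (F-cong x α≈β)

  -- One Bailey step on the unit pair, in which only s = 0 survives. The constant value 1 matches a
  -- chain with no links left.
  H-base : ∀ x → H (plain 0) x ≈ 1#
  H-base x = begin
    poch q x * poch⁻ x * F (plain 0) x
      ≈⟨ *-assoc _ _ _ ⟩
    poch q x * (poch⁻ x * F (plain 0) x)
      ≈⟨ *-congˡ (*-congˡ (F-cong x (λ j → sym (tri-unit j)))) ⟩
    poch q x * (poch⁻ x * F (λ j → tri j * unit j) x)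
      ≈⟨ *-congˡ (bailey-lemma unit x) ⟨
    poch q x * ∑ (suc x) (λ s → tri s * poch⁻ s * (rs x s * F unit s))
      ≈⟨ *-congˡ (trans (∑-first x _) (+-cong (*-congˡ (*-congˡ F-unit-zero))
           (∑-zero x (λ k _ → trans (*-congˡ (trans (*-congˡ (F-unit-suc k)) (zeroʳ _))) (zeroʳ _))))) ⟩
    poch q x * (1# * 1# * (r x * 1#) + 0#)
      ≈⟨ solve 2 (λ p r → p :* (:1 :* :1 :* (r :* :1) :+ con (+ 0)) := r :* p) refl _ _ ⟩
    r x * poch q x
      ≈⟨ r-inverse x ⟩
    1# ∎

  qbinom : ℕ → ℕ → Carrier
  qbinom N M = poch q N * (r M * rs N M)

  H-step : ∀ α N → ∑ (suc N) (λ s → tri s * (qbinom N s * H α s)) ≈ H (λ j → tri j * α j) N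
  H-step α N = begin
    ∑ (suc N) (λ s → tri s * (qbinom N s * H α s))
      ≈⟨ ∑-cong (suc N) (λ s _ → begin
           tri s * (poch q N * (r s * rs N s) * (poch q s * poch⁻ s * F α s))
             ≈⟨ solve 7 (λ t P r R p p⁻ F → t :* (P :* (r :* R) :* (p :* p⁻ :* F)) := P :* ((r :* p) :* (t :* p⁻ :* (R :* F)))) refl _ _ _ _ _ _ _ ⟩
           poch q N * ((r s * poch q s) * (tri s * poch⁻ s * (rs N s * F α s)))
             ≈⟨ *-congˡ (trans (*-congʳ (r-inverse s)) (*-identityˡ _)) ⟩
           poch q N * (tri s * poch⁻ s * (rs N s * F α s)) ∎) ⟩
    ∑ (suc N) (λ s → poch q N * (tri s * poch⁻ s * (rs N s * F α s)))
      ≈⟨ *-distribˡ-∑ _ (suc N) _ ⟨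
    poch q N * ∑ (suc N) (λ s → tri s * poch⁻ s * (rs N s * F α s))
      ≈⟨ *-congˡ (bailey-lemma α N) ⟩
    poch q N * (poch⁻ N * F (λ j → tri j * α j) N)
      ≈⟨ *-assoc _ _ _ ⟨
    H (λ j → tri j * α j) N ∎

  -- Both sides are regrouped by the bilateral weight (-1)ⁱ q^(e·i(i-1)/2); the coefficients then agree term by term.
  F-shift : ∀ e N → (1# - q ^ suc N * q ^ suc N) * F (plain e) (suc N) ≈ F (shifted e) N
  F-shift e N = begin
    W * F (plain e) (suc N)
      ≈⟨ *-distribˡ-∑ _ (suc (suc N)) _ ⟩
    ∑ (suc (suc N)) (λ j → W * (plain e j * κ (suc N) j))
      ≈⟨ ∑-first (suc N) _ ⟩
    W * (plain e 0 * κ (suc N) 0) + ∑ (suc N) (λ j → W * (plain e (suc j) * κ (suc N) (suc j)))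
      -- The e-th powers dictate the grouping: term j + 1 on the left carries `tri (suc j) ^ e`,
      -- shared on the right by a (j + 2) and b j, whereas a 0 and a 1 carry 1.
      ≈⟨ +-cong head (∑-cong (suc N) (λ j _ → tail j)) ⟩
    (a 0 + a 1) + ∑ (suc N) (λ j → a (suc (suc j)) + b j)
      ≈⟨ +-congˡ (∑-distrib-+ (suc N) _ _) ⟩
    (a 0 + a 1) + (∑ (suc N) (λ j → a (suc (suc j))) + ∑ (suc N) b)
      ≈⟨ solve 4 (λ x y z w → (x :+ y) :+ (z :+ w) := (x :+ (y :+ z)) :+ w) refl _ _ _ _ ⟩
    (a 0 + (a 1 + ∑ (suc N) (λ j → a (suc (suc j))))) + ∑ (suc N) b
      ≈⟨ +-congʳ (trans (∑-first (suc (suc N)) a) (+-congˡ (∑-first (suc N) (λ j → a (suc j))))) ⟨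
    ∑ (suc (suc (suc N))) a + ∑ (suc N) b
      -- The regrouped `a` runs two terms too far, to N + 2, where the kernel is zero.
      ≈⟨ +-congʳ (∑-extend (λ j N<j → trans (*-congˡ (κ-large N<j)) (zeroʳ _)) (ℕₚ.m≤n+m (suc N) 2)) ⟩
    ∑ (suc N) a + ∑ (suc N) b
      ≈⟨ ∑-distrib-+ (suc N) a b ⟨
    ∑ (suc N) (λ j → a j + b j)
      ≈⟨ ∑-cong (suc N) (λ j _ → solve 3 (λ A B k → A :* k :+ (:- B) :* k := (A :- B) :* k) refl _ _ _) ⟩
    F (shifted e) N ∎
    where
    y W : Carrier
    y = q ^ N
    W = 1# - q ^ suc N * q ^ suc N
    a b : ℕ → Carrier
    a j = sgn j * (bin j ^ e * (tri j * bin j)) * κ N j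
    b j = - (sgn j * (tri (suc j) ^ e * (tri (suc j) * tri j))) * κ N j

    head : W * (plain e 0 * κ (suc N) 0) ≈ a 0 + a 1
    head = begin
      W * (1# * (1# ^ e * (1# * 1# - 1# * (q * 1#) * 1#)) * (r (suc N) * r (suc (suc N) ℕ.+ 0)))
        ≈⟨ *-congˡ (*-congʳ (*-congˡ (*-congʳ (1^ e)))) ⟩
      W * (1# * (1# * (1# * 1# - 1# * (q * 1#) * 1#)) * (r (suc N) * ρ))
        ≈⟨ solve 4 (λ q y R ρ →
             (:1 :- (q :* y) :* (q :* y)) :* (:1 :* (:1 :* (:1 :* :1 :- :1 :* (q :* :1) :* :1)) :* (R :* ρ))
             := :1 :* (:1 :* (:1 :* :1)) :* (((:1 :- q :* y) :* R) :* ((:1 :- q :* ((q :* y) :* :1)) :* ρ))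
                :+ (:- :1 :* :1) :* (:1 :* (:1 :* (q :* :1) :* :1)) :* (((:1 :- y) :* ((:1 :- q :* y) :* R)) :* ρ)) refl q y _ ρ ⟩
      1# * (1# * (1# * 1#)) * (((1# - q * y) * r (suc N)) * ((1# - q * ((q * y) * 1#)) * ρ))
        + (- 1# * 1#) * (1# * (1# * (q * 1#) * 1#)) * (((1# - y) * ((1# - q * y) * r (suc N))) * ρ)
        ≈⟨ +-cong (*-cong (*-congˡ (*-congʳ (1^ e))) (*-cong (r-step N) (r-step-+ (suc N) 0)))
                  (*-cong (*-congˡ (*-congʳ (1^ e)))
                          (*-cong (trans (rs-step N 0) (*-congˡ (r-step N))) (reflexive (≡.cong (λ k → r (suc k)) (ℕₚ.+-suc N 0))))) ⟨
      a 0 + a 1 ∎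
      where
      ρ = r (suc (suc N) ℕ.+ 0)

    rs-step₂ : ∀ j → q * (q ^ j * q ^ j) * rs N (suc (suc j)) ≈ (q * q ^ j - y) * (q ^ j - y) * rs N j
    rs-step₂ j = begin
      q * (x * x) * rs N (suc (suc j))                 ≈⟨ solve 3 (λ q x ρ → q :* (x :* x) :* ρ := x :* (q :* x :* ρ)) refl q x _ ⟩
      x * (q ^ suc j * rs N (suc (suc j)))             ≈⟨ *-congˡ (rs-step-power N (suc j)) ⟩
      x * ((q * x - y) * rs N (suc j))                 ≈⟨ solve 3 (λ x z ρ → x :* (z :* ρ) := z :* (x :* ρ)) refl x _ _ ⟩
      (q * x - y) * (x * rs N (suc j))                 ≈⟨ *-congˡ (rs-step-power N j) ⟩
      (q * x - y) * ((x - y) * rs N j)                 ≈⟨ *-assoc _ _ _ ⟨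
      (q * x - y) * (x - y) * rs N j                   ∎
      where x = q ^ j

    tail : ∀ j → W * (plain e (suc j) * κ (suc N) (suc j)) ≈ a (suc (suc j)) + b j
    tail j = sym (begin
      a (suc (suc j)) + b j
        ≈⟨ +-cong (*-congˡ (*-congˡ (reflexive (≡.cong (λ k → r (suc k)) (≡.trans (ℕₚ.+-suc N (suc j)) (≡.cong suc (ℕₚ.+-suc N j)))))))
                  (*-congˡ (*-congˡ (trans (r-step-+ (suc N) j) (*-congˡ (r-step-+ (suc (suc N)) j))))) ⟩
      (- 1# * (- 1# * s)) * (v * (t * (q * x) * (q * (q * x)) * (t * (q * x)))) * (rs N (suc (suc j)) * ρ)
        + - (s * (v * (t * (q * x) * t))) * (rs N j * ((1# - q * (q * y * x)) * ((1# - q * (q * (q * y) * x)) * ρ)))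
        ≈⟨ solve 9 (λ s v t q x y R R₂ ρ →
             (:- :1 :* (:- :1 :* s)) :* (v :* (t :* (q :* x) :* (q :* (q :* x)) :* (t :* (q :* x)))) :* (R₂ :* ρ)
             :+ :- (s :* (v :* (t :* (q :* x) :* t))) :* (R :* ((:1 :- q :* (q :* y :* x)) :* ((:1 :- q :* (q :* (q :* y) :* x)) :* ρ)))
             := s :* v :* t :* t :* (q :* x) :* ρ :*
                (q :* q :* (q :* (x :* x) :* R₂) :- (:1 :- q :* (q :* y :* x)) :* (:1 :- q :* (q :* (q :* y) :* x)) :* R))
             refl s v t q x y (rs N j) _ ρ ⟩
      s * v * t * t * (q * x) * ρ *
        (q * q * (q * (x * x) * rs N (suc (suc j))) - (1# - q * (q * y * x)) * (1# - q * (q * (q * y) * x)) * rs N j)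
        ≈⟨ *-congˡ (+-congʳ (*-congˡ (rs-step₂ j))) ⟩
      s * v * t * t * (q * x) * ρ *
        (q * q * ((q * x - y) * (x - y) * rs N j) - (1# - q * (q * y * x)) * (1# - q * (q * (q * y) * x)) * rs N j)
        -- The terms in xy cancel: the bracket is -(1 - q²y²)(1 - q³x²) times `rs N j`. The first
        -- factor is `W`, the second comes from the difference in `plain`.
        ≈⟨ solve 8 (λ s v t q x y R ρ →
             s :* v :* t :* t :* (q :* x) :* ρ :*
             (q :* q :* ((q :* x :- y) :* (x :- y) :* R) :- (:1 :- q :* (q :* y :* x)) :* (:1 :- q :* (q :* (q :* y) :* x)) :* R)
             := (:1 :- (q :* y) :* (q :* y)) :* ((:- :1 :* s) :* (v :* (t :* (q :* x) :* t :- t :* (q :* x) :* (q :* (q :* x)) :* (t :* (q :* x)))) :* (R :* ρ)))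
             refl s v t q x y (rs N j) ρ ⟩
      W * ((- 1# * s) * (v * (t * (q * x) * t - t * (q * x) * (q * (q * x)) * (t * (q * x)))) * (rs N j * ρ))
        ≈⟨ *-congˡ (*-congˡ (*-congˡ (reflexive (≡.cong (λ k → r (suc (suc k))) (≡.sym (ℕₚ.+-suc N j)))))) ⟩
      W * (plain e (suc j) * κ (suc N) (suc j)) ∎)
      where
      s = sgn j
      t = tri j
      x = q ^ j
      v = tri (suc j) ^ e
      ρ = r (suc (suc (suc (N ℕ.+ j))))

  -- The prefactors at x + 1 exceed those at x by (1 - q^(x+1))(1 + q^(x+1)), exactly the factor
  -- that `F-shift` needs.
  H-shift : ∀ e x → H (plain e) (suc x) ≈ H (shifted e) x
  H-shift e x = begin
    poch q x * (1# - q * q ^ x) * (poch⁻ x * (1# - - q * q ^ x)) * F (plain e) (suc x)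
      ≈⟨ solve 5 (λ p p⁻ q y F → p :* (:1 :- q :* y) :* (p⁻ :* (:1 :- :- q :* y)) :* F := p :* p⁻ :* ((:1 :- q :* y :* (q :* y)) :* F)) refl _ _ q (q ^ x) _ ⟩
    poch q x * poch⁻ x * ((1# - q ^ suc x * q ^ suc x) * F (plain e) (suc x))
      ≈⟨ *-congˡ (F-shift e x) ⟩
    H (shifted e) x ∎

-- Evaluation of the multiple sum when q^k = 0 for k > n.

δ-refl : ∀ a → δ a a ≡ 1
δ-refl zero    = ≡.refl
δ-refl (suc a) = δ-refl a

δ-< : ∀ {a i} → a < i → δ a i ≡ 0
δ-< {zero}  {suc i} _         = ≡.refl
δ-< {suc a} {suc i} (s≤s a<i) = δ-< a<i

δ-> : ∀ {a i} → i < a → δ a i ≡ 0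
δ-> {suc a} {zero}  _         = ≡.refl
δ-> {suc a} {suc i} (s≤s i<a) = δ-> i<a

module Truncated {c ℓ} (R : CommutativeRing c ℓ) (q : CommutativeRing.Carrier R)
  (r : ℕ → CommutativeRing.Carrier R)
  (r-inverse : QSeries.Reciprocal R q r)
  (n : ℕ) (q-vanish : QSeries.VanishesAfter R q n) where
  open CommutativeRing R renaming (zero to *-zero)
  open IntegerSolver R
  open FiniteSums R
  open QSeries R q
  open Bailey R q r r-inverse
  open BaileyPairs R q r r-inverse
  open import Algebra.Properties.Semiring.Exp semiring using (^-congˡ; ^-assocʳ)
  open import Relation.Binary.Reasoning.Setoid setoid

  tri-vanish : ∀ k → n < k → tri k ≈ 0#
  tri-vanish (suc k) n<k = trans (*-congˡ (q-vanish (suc k) n<k)) (zeroʳ _)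

  poch-limit : ∀ {k} → n ≤ k → poch q k ≈ poch q n
  poch-limit = poch-stable (λ k n≤k → q-vanish (suc k) (s≤s n≤k))

  r-limit : ∀ {k} → n ≤ k → r k ≈ r n
  r-limit {k} n≤k = cancelˡ (r-inverse n) (begin
    poch q n * r k   ≈⟨ *-congʳ (poch-limit n≤k) ⟨
    poch q k * r k   ≈⟨ *-comm _ _ ⟩
    r k * poch q k   ≈⟨ r-inverse k ⟩
    1#               ≈⟨ r-inverse n ⟨
    r n * poch q n   ≈⟨ *-comm _ _ ⟩
    poch q n * r n   ∎)

  rs-limit : ∀ {j} → j ≤ n → rs (n ℕ.+ n) j ≈ r n
  rs-limit {j} j≤n = begin
    rs (n ℕ.+ n) j                    ≡⟨ ≡.cong (λ k → rs k j) (ℕₚ.m+[n∸m]≡n (ℕₚ.≤-trans j≤n (ℕₚ.m≤m+n n n))) ⟨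
    rs (j ℕ.+ (n ℕ.+ n ∸ j)) j        ≡⟨ rs-+ j (n ℕ.+ n ∸ j) ⟩
    r (n ℕ.+ n ∸ j)                   ≈⟨ r-limit (ℕₚ.≤-trans (ℕₚ.≤-reflexive (≡.sym (ℕₚ.m+n∸n≡m n j))) (ℕₚ.∸-monoˡ-≤ j (ℕₚ.+-monoʳ-≤ n j≤n))) ⟩
    r n                               ∎

  -- Past n the factor `tri s` vanishes, past N the binomial does; so every sum can run over the
  -- same box {0, ..., n}, whatever N is.
  H-step-truncated : ∀ α N → ∑ (suc n) (λ s → tri s * (qbinom N s * H α s)) ≈ H (λ j → tri j * α j) N
  H-step-truncated α N = trans
    (∑-support (λ s n<s → trans (*-congʳ (tri-vanish s n<s)) (zeroˡ _))
               (λ s N<s → trans (*-congˡ (trans (*-congʳ (trans (*-congˡ (trans (*-congˡ (rs-large N<s)) (zeroʳ _))) (zeroʳ _))) (zeroˡ _))) (zeroʳ _)))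
    (H-step α N)

  ∑box : ∀ m → (Vec ℕ m → Carrier) → Carrier
  ∑box zero    f = f []
  ∑box (suc m) f = ∑ (suc n) (λ x → ∑box m (λ v → f (x ∷ v)))

  ∑box-cong : ∀ m {f g : Vec ℕ m → Carrier} → (∀ v → f v ≈ g v) → ∑box m f ≈ ∑box m g
  ∑box-cong zero    f≈g = f≈g []
  ∑box-cong (suc m) f≈g = ∑-cong (suc n) (λ x _ → ∑box-cong m (λ v → f≈g (x ∷ v)))

  *-distribˡ-∑box : ∀ x m (f : Vec ℕ m → Carrier) → x * ∑box m f ≈ ∑box m (λ v → x * f v)
  *-distribˡ-∑box x zero    f = refl
  *-distribˡ-∑box x (suc m) f = trans (*-distribˡ-∑ x (suc n) _)
    (∑-cong (suc n) (λ y _ → *-distribˡ-∑box x m (λ v → f (y ∷ v))))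

  triangle : ∀ {m} → Vec ℕ m → Carrier
  triangle []      = 1#
  triangle (x ∷ v) = tri x * triangle v

  links : ℕ → ℕ → ∀ {k} → Vec ℕ k → Carrier
  links a i []          = 1#
  links a i (x ∷ [])    = 1#
  links a i (x ∷ y ∷ v) = qbinom (x ℕ.+ δ a i) y * links a (suc i) (y ∷ v)

  -- The inner sum over N_(i+1), ..., N_(i+k) for a fixed value x of N_i; the weight of N_i itself
  -- is left out.
  chain-sum : ℕ → ℕ → ℕ → ℕ → Carrier
  chain-sum a i k x = ∑box k (λ v → triangle v * links a i (x ∷ v))

  chain-sum-zero : ∀ a i x → chain-sum a i 0 x ≈ 1#
  chain-sum-zero a i x = *-identityˡ 1#

  chain-sum-suc : ∀ a i k x →
    chain-sum a i (suc k) x ≈ ∑ (suc n) (λ y → tri y * (qbinom (x ℕ.+ δ a i) y * chain-sum a (suc i) k y))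
  chain-sum-suc a i k x = ∑-cong (suc n) (λ y _ → begin
    ∑box k (λ v → tri y * triangle v * (qbinom (x ℕ.+ δ a i) y * links a (suc i) (y ∷ v)))
      ≈⟨ ∑box-cong k (λ v → solve 4 (λ t T b l → t :* T :* (b :* l) := t :* (b :* (T :* l))) refl _ _ _ _) ⟩
    ∑box k (λ v → tri y * (qbinom (x ℕ.+ δ a i) y * (triangle v * links a (suc i) (y ∷ v))))
      ≈⟨ *-distribˡ-∑box (tri y) k _ ⟨
    tri y * ∑box k (λ v → qbinom (x ℕ.+ δ a i) y * (triangle v * links a (suc i) (y ∷ v)))
      ≈⟨ *-congˡ (*-distribˡ-∑box _ k _) ⟨
    tri y * (qbinom (x ℕ.+ δ a i) y * chain-sum a (suc i) k y) ∎)

  -- From index a on, a delta can occur only in the first link. Keeping it in the argument x + δ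
  -- treats i = a and i > a at once, and the recursive call always has a < i + 1.
  chain-sum-plain : ∀ {a} k {i} x → a ≤ i → chain-sum a i k x ≈ H (plain k) (x ℕ.+ δ a i)
  chain-sum-plain {a} zero {i} x a≤i = trans (chain-sum-zero a i x) (sym (H-base (x ℕ.+ δ a i)))
  chain-sum-plain {a} (suc k) {i} x a≤i = begin
    chain-sum a i (suc k) x
      ≈⟨ chain-sum-suc a i k x ⟩
    ∑ (suc n) (λ y → tri y * (qbinom N y * chain-sum a (suc i) k y))
      ≈⟨ ∑-cong (suc n) (λ y _ → *-congˡ (*-congˡ (trans (chain-sum-plain k y (ℕₚ.m≤n⇒m≤1+n a≤i))
           (reflexive (≡.cong (H (plain k)) (≡.trans (≡.cong (y ℕ.+_) (δ-< (s≤s a≤i))) (ℕₚ.+-identityʳ y))))))) ⟩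
    ∑ (suc n) (λ y → tri y * (qbinom N y * H (plain k) y))
      ≈⟨ H-step-truncated (plain k) N ⟩
    H (λ j → tri j * plain k j) N
      ≈⟨ H-cong N (tri-plain k) ⟩
    H (plain (suc k)) N ∎
    where N = x ℕ.+ δ a i

  -- Here d counts the links before the one with the delta. At d = 0 the delta raises x by 1 and
  -- `H-shift` absorbs it; every earlier link is an ordinary Bailey step.
  chain-sum-shifted : ∀ d e i x → chain-sum (i ℕ.+ d) i (d ℕ.+ e) x ≈ H (λ j → tri j ^ d * shifted e j) x
  chain-sum-shifted zero e i x rewrite ℕₚ.+-identityʳ i = begin
    chain-sum i i e x
      ≈⟨ chain-sum-plain e x ℕₚ.≤-refl ⟩
    H (plain e) (x ℕ.+ δ i i)
      ≡⟨ ≡.cong (H (plain e)) (≡.trans (≡.cong (x ℕ.+_) (δ-refl i)) (ℕₚ.+-comm x 1)) ⟩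
    H (plain e) (suc x)
      ≈⟨ H-shift e x ⟩
    H (shifted e) x
      ≈⟨ H-cong x (λ j → *-identityˡ _) ⟨
    H (λ j → 1# * shifted e j) x ∎
  chain-sum-shifted (suc d) e i x = begin
    chain-sum (i ℕ.+ suc d) i (suc d ℕ.+ e) x
      ≈⟨ chain-sum-suc (i ℕ.+ suc d) i (d ℕ.+ e) x ⟩
    ∑ (suc n) (λ y → tri y * (qbinom (x ℕ.+ δ (i ℕ.+ suc d) i) y * chain-sum (i ℕ.+ suc d) (suc i) (d ℕ.+ e) y))
      ≡⟨ ≡.cong₂ (λ N a → ∑ (suc n) (λ y → tri y * (qbinom N y * chain-sum a (suc i) (d ℕ.+ e) y)))
           (≡.trans (≡.cong (x ℕ.+_) (δ-> (ℕₚ.m<m+n i (s≤s z≤n)))) (ℕₚ.+-identityʳ x)) (ℕₚ.+-suc i d) ⟩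
    ∑ (suc n) (λ y → tri y * (qbinom x y * chain-sum (suc i ℕ.+ d) (suc i) (d ℕ.+ e) y))
      ≈⟨ ∑-cong (suc n) (λ y _ → *-congˡ (*-congˡ (chain-sum-shifted d e (suc i) y))) ⟩
    ∑ (suc n) (λ y → tri y * (qbinom x y * H (λ j → tri j ^ d * shifted e j) y))
      ≈⟨ H-step-truncated _ x ⟩
    H (λ j → tri j * (tri j ^ d * shifted e j)) x
      ≈⟨ H-cong x (λ j → *-assoc _ _ _) ⟨
    H (λ j → tri j ^ suc d * shifted e j) x ∎

  total : ℕ → ℕ → Carrier
  total a k = ∑ (suc n) (λ x → tri x * (r x * chain-sum a 1 k x))

  -- 1/(q)_x is the limit of [N, x], so the outermost sum is one more Bailey step, with N = 2n for
  -- infinity. Multiplying by 1/(q)_n supplies the factor 1/(q)_(N-x) of the lemma.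
  total-limit : ∀ a k α → (∀ x → chain-sum a 1 k x ≈ H α x) →
                total a k ≈ poch⁻ (n ℕ.+ n) * r n * ∑ (suc (n ℕ.+ n)) (λ j → tri j * α j)
  total-limit a k α chain≈H = cancelˡ {u = poch q n} (trans (*-comm _ _) (r-inverse n)) (begin
    r n * total a k
      ≈⟨ *-distribˡ-∑ (r n) (suc n) _ ⟩
    ∑ (suc n) (λ x → r n * (tri x * (r x * chain-sum a 1 k x)))
      ≈⟨ ∑-cong (suc n) (λ x x<sn → begin
           r n * (tri x * (r x * chain-sum a 1 k x))
             ≈⟨ *-cong (sym (rs-limit (ℕ.s≤s⁻¹ x<sn))) (*-congˡ (*-congˡ (chain≈H x))) ⟩
           rs N x * (tri x * (r x * (poch q x * poch⁻ x * F α x)))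
             ≈⟨ solve 6 (λ R t r p p⁻ F → R :* (t :* (r :* (p :* p⁻ :* F))) := (r :* p) :* (t :* p⁻ :* (R :* F))) refl _ _ _ _ _ _ ⟩
           (r x * poch q x) * (tri x * poch⁻ x * (rs N x * F α x))
             ≈⟨ trans (*-congʳ (r-inverse x)) (*-identityˡ _) ⟩
           tri x * poch⁻ x * (rs N x * F α x) ∎) ⟩
    ∑ (suc n) (λ x → tri x * poch⁻ x * (rs N x * F α x))
      ≈⟨ ∑-extend (λ x n<x → trans (*-congʳ (trans (*-congʳ (tri-vanish x n<x)) (zeroˡ _))) (zeroˡ _)) (s≤s (ℕₚ.m≤m+n n n)) ⟨
    ∑ (suc N) (λ x → tri x * poch⁻ x * (rs N x * F α x))
      ≈⟨ bailey-lemma α N ⟩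
    poch⁻ N * ∑ (suc N) (λ j → tri j * α j * κ N j)
      ≈⟨ *-congˡ (trans (∑-cong (suc N) (λ j _ → term j)) (sym (*-distribˡ-∑ _ (suc N) _))) ⟩
    poch⁻ N * (r n * r n * ∑ (suc N) (λ j → tri j * α j))
      ≈⟨ solve 3 (λ p r S → p :* (r :* r :* S) := r :* (p :* r :* S)) refl _ _ _ ⟩
    r n * (poch⁻ N * r n * ∑ (suc N) (λ j → tri j * α j)) ∎)
    where
    N = n ℕ.+ n
    term : ∀ j → tri j * α j * κ N j ≈ r n * r n * (tri j * α j)
    term j with j ℕₚ.≤? n
    ... | yes j≤n = trans (*-comm _ _)
      (*-congʳ (*-cong (rs-limit j≤n) (r-limit (ℕₚ.m≤n⇒m≤1+n (ℕₚ.≤-trans (ℕₚ.m≤m+n n n) (ℕₚ.m≤m+n N j))))))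
    ... | no  j≰n = trans (trans (*-congʳ zero′) (zeroˡ _)) (sym (trans (*-congˡ zero′) (zeroʳ _)))
      where
      zero′ : tri j * α j ≈ 0#
      zero′ = trans (*-congʳ (tri-vanish j (ℕₚ.≰⇒> j≰n))) (zeroˡ _)

  ^-distrib-* : ∀ x y k → (x * y) ^ k ≈ x ^ k * y ^ k
  ^-distrib-* x y zero    = sym (*-identityˡ 1#)
  ^-distrib-* x y (suc k) = trans (*-congˡ (^-distrib-* x y k))
    (solve 4 (λ x y a b → x :* y :* (a :* b) := x :* a :* (y :* b)) refl _ _ _ _)

  ^-swap : ∀ x j k → (x ^ j) ^ k ≈ (x ^ k) ^ j
  ^-swap x j k = trans (^-assocʳ x j k) (trans (reflexive (≡.cong (x ^_) (ℕₚ.*-comm j k))) (sym (^-assocʳ x k j)))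

  module _ (Q : Carrier) where
    open QSeries R Q using () renaming (wt to wtQ)

    -- a j + (a+e) j(j-1)/2 = a j(j+1)/2 + e j(j-1)/2.
    wt-closed : ∀ a e → q ^ a * q ^ e ≈ Q → ∀ j → wtQ (q ^ a) j ≈ sgn j * (tri j ^ a * bin j ^ e)
    wt-closed a e Q≈ zero = sym (trans (*-identityˡ _) (trans (*-cong (1^ a) (1^ e)) (*-identityˡ 1#)))
    wt-closed a e Q≈ (suc j) = begin
      wtQ (q ^ a) j * - (q ^ a * Q ^ j)
        ≈⟨ *-cong (wt-closed a e Q≈ j) (-‿cong (*-congˡ (trans (^-congˡ j (sym Q≈)) (^-distrib-* _ _ j)))) ⟩
      sgn j * (tri j ^ a * bin j ^ e) * - (q ^ a * ((q ^ a) ^ j * (q ^ e) ^ j))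
        ≈⟨ *-congˡ (-‿cong (*-congˡ (*-cong (^-swap q a j) (^-swap q e j)))) ⟩
      sgn j * (tri j ^ a * bin j ^ e) * - (q ^ a * ((q ^ j) ^ a * (q ^ j) ^ e))
        ≈⟨ solve 6 (λ s t b x y z → s :* (t :* b) :* :- (x :* (y :* z)) := :- :1 :* s :* (t :* (x :* y) :* (b :* z))) refl _ _ _ _ _ _ ⟩
      - 1# * sgn j * (tri j ^ a * (q ^ a * (q ^ j) ^ a) * (bin j ^ e * (q ^ j) ^ e))
        ≈⟨ *-congˡ (*-cong (trans (^-distrib-* _ _ a) (*-congˡ (^-distrib-* _ _ a)))
                           (trans (^-congˡ e (tri≈bin j)) (^-distrib-* _ _ e))) ⟨
      sgn (suc j) * (tri (suc j) ^ a * bin (suc j) ^ e) ∎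

  -- As N → ∞ this becomes Euler's (-q;q)_∞ (q;q²)_∞ = 1.
  euler : ∀ N → poch⁻ N * QSeries.poch R (q ^ 2) q N * poch q N ≈ poch q (N ℕ.+ N)
  euler zero    = solve 0 (:1 :* :1 :* :1 := :1) refl
  euler (suc N) rewrite ℕₚ.+-suc N N = begin
    poch⁻ N * (1# - - q * q ^ N) * (p₂ * (1# - q * (q ^ 2) ^ N)) * (poch q N * (1# - q * q ^ N))
      ≈⟨ *-congʳ (*-congˡ (*-congˡ (+-congˡ (-‿cong (*-congˡ (trans (^-swap q 2 N) (*-congˡ (*-identityʳ _)))))))) ⟩
    poch⁻ N * (1# - - q * q ^ N) * (p₂ * (1# - q * (q ^ N * q ^ N))) * (poch q N * (1# - q * q ^ N))
      ≈⟨ solve 5 (λ p⁻ p₂ p q x →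
           p⁻ :* (:1 :- :- q :* x) :* (p₂ :* (:1 :- q :* (x :* x))) :* (p :* (:1 :- q :* x))
           := p⁻ :* p₂ :* p :* (:1 :- q :* (x :* x)) :* (:1 :- q :* (q :* (x :* x)))) refl _ _ _ q (q ^ N) ⟩
    poch⁻ N * p₂ * poch q N * (1# - q * (q ^ N * q ^ N)) * (1# - q * (q * (q ^ N * q ^ N)))
      ≈⟨ *-cong (*-cong (euler N) (+-congˡ (-‿cong (*-congˡ (sym (^-homo-* q N N))))))
                (+-congˡ (-‿cong (*-congˡ (*-congˡ (sym (^-homo-* q N N)))))) ⟩
    poch q (N ℕ.+ N) * (1# - q * q ^ (N ℕ.+ N)) * (1# - q * q ^ suc (N ℕ.+ N)) ∎
    where p₂ = QSeries.poch R (q ^ 2) q N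

  power-vanish : ∀ c d k → n ≤ k → q ^ suc c * (q ^ suc d) ^ k ≈ 0#
  power-vanish c d k n≤k = trans
    (trans (*-congˡ (^-assocʳ q (suc d) k)) (sym (^-homo-* q (suc c) (suc d ℕ.* k))))
    (q-vanish (suc c ℕ.+ suc d ℕ.* k)
      (s≤s (ℕₚ.≤-trans n≤k (ℕₚ.≤-trans (ℕₚ.m≤m+n k (d ℕ.* k)) (ℕₚ.m≤n+m (suc d ℕ.* k) c)))))

  -- In `euler` at N = 2n both (q)_N and (q)_2N equal (q)_n, which cancels; the claim is then
  -- uniqueness of inverses.
  poch⁻-inverse : ∀ {h} → h * QSeries.poch R (q ^ 2) q n ≈ 1# → poch⁻ (n ℕ.+ n) ≈ h
  poch⁻-inverse {h} h-inverse = begin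
    poch⁻ N                          ≈⟨ *-identityʳ _ ⟨
    poch⁻ N * 1#                     ≈⟨ *-congˡ h-inverse ⟨
    poch⁻ N * (h * p₂ n)             ≈⟨ solve 3 (λ a h p → a :* (h :* p) := h :* (a :* p)) refl _ _ _ ⟩
    h * (poch⁻ N * p₂ n)             ≈⟨ *-congˡ (*-congˡ (QSeries.poch-stable R (q ^ 2) vanish (ℕₚ.m≤m+n n n))) ⟨
    h * (poch⁻ N * p₂ N)             ≈⟨ *-congˡ (cancelˡ (r-inverse n) (begin
      poch q n * (poch⁻ N * p₂ N)      ≈⟨ *-comm _ _ ⟩
      poch⁻ N * p₂ N * poch q n        ≈⟨ *-congˡ (poch-limit (ℕₚ.m≤m+n n n)) ⟨
      poch⁻ N * p₂ N * poch q N        ≈⟨ euler N ⟩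
      poch q (N ℕ.+ N)                 ≈⟨ poch-limit (ℕₚ.≤-trans (ℕₚ.m≤m+n n n) (ℕₚ.m≤m+n N N)) ⟩
      poch q n                         ≈⟨ *-identityʳ _ ⟨
      poch q n * 1#                    ∎)) ⟩
    h * 1#                           ≈⟨ *-identityʳ _ ⟩
    h                                ∎
    where
    N = n ℕ.+ n
    p₂ = QSeries.poch R (q ^ 2) q
    vanish : ∀ k → n ≤ k → q * (q ^ 2) ^ k ≈ 0#
    vanish k n≤k = trans (*-congʳ (sym (*-identityʳ q))) (power-vanish 0 1 k n≤k)

  -- With the delta at a = d + 1 and m = d + 1 + e, the three powers are q^(m+2), q^(a+1) and
  -- q^(m+1-a).
  total-product : ∀ d e {u h} → let Q = q ^ suc (suc (suc (d ℕ.+ e))) in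
    let pochQ = λ z → QSeries.poch R Q z n in
    u * pochQ Q ≈ 1# → h * QSeries.poch R (q ^ 2) q n ≈ 1# →
    total (suc d) (d ℕ.+ e) ≈ pochQ (q ^ suc (suc d)) * pochQ (q ^ suc e) * pochQ Q * r n * h
  total-product d e {u} {h} u-inverse h-inverse = begin
    total (suc d) (d ℕ.+ e)
      ≈⟨ total-limit (suc d) (d ℕ.+ e) α (chain-sum-shifted d e 1) ⟩
    poch⁻ (n ℕ.+ n) * r n * ∑ (suc (n ℕ.+ n)) (λ j → tri j * α j)
      ≈⟨ *-cong (*-congʳ (poch⁻-inverse h-inverse)) (trans (∑-cong (suc (n ℕ.+ n)) (λ j _ → term j))
           (sym (truncated-jtp (power-vanish (suc d) (suc (suc (d ℕ.+ e)))) (power-vanish e (suc (suc (d ℕ.+ e))))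
                               (power-vanish (suc (suc (d ℕ.+ e))) (suc (suc (d ℕ.+ e)))) u-inverse))) ⟩
    h * r n * (pochQ Q * (pochQ z * pochQ w))
      ≈⟨ solve 5 (λ h r P z w → h :* r :* (P :* (z :* w)) := z :* w :* P :* r :* h) refl _ _ _ _ _ ⟩
    pochQ z * pochQ w * pochQ Q * r n * h ∎
    where
    Q z w : Carrier
    Q = q ^ suc (suc (suc (d ℕ.+ e)))
    z = q ^ suc (suc d)
    w = q ^ suc e
    pochQ : Carrier → Carrier
    pochQ z = QSeries.poch R Q z n
    zw≈Q : z * w ≈ Q
    zw≈Q = trans (sym (^-homo-* q (suc (suc d)) (suc e))) (reflexive (≡.cong (λ k → q ^ suc (suc k)) (ℕₚ.+-suc d e)))
    open QSeries R Q using () renaming (wt to wtQ)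
    open QSeries.JacobiTripleProduct R Q z w zw≈Q using (truncated-jtp)
    α : ℕ → Carrier
    α j = tri j ^ d * shifted e j
    term : ∀ j → tri j * α j ≈ wtQ z j + wtQ w (suc j)
    term j = begin
      tri j * (tri j ^ d * (sgn j * (bin j ^ e * (tri j * bin j)) - sgn j * (tri (suc j) ^ e * (tri (suc j) * tri j))))
        -- As `tri j` is `bin (suc j)`, the second monomial fits `wt-closed` at j + 1 with the two
        -- exponents exchanged; its minus sign turns sgn j into sgn (j + 1).
        ≈⟨ solve 7 (λ t td s be b t₁ t₁e →
             t :* (td :* (s :* (be :* (t :* b)) :- s :* (t₁e :* (t₁ :* t))))
             := s :* (t :* (t :* td) :* (b :* be)) :+ :- :1 :* s :* (t₁ :* t₁e :* (t :* (t :* td)))) refl _ _ _ _ _ _ _ ⟩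
      sgn j * (tri j ^ suc (suc d) * bin j ^ suc e) + sgn (suc j) * (tri (suc j) ^ suc e * bin (suc j) ^ suc (suc d))
        ≈⟨ +-cong (wt-closed Q (suc (suc d)) (suc e) zw≈Q j)
                  (wt-closed Q (suc e) (suc (suc d)) (trans (*-comm _ _) zw≈Q) (suc j)) ⟨
      wtQ z j + wtQ w (suc j) ∎

-- Power series modulo q^(n+1) as a commutative ring.

module ℤ∑ = FiniteSums ℤₚ.+-*-commutativeRing

sumℤ-map-upTo : ∀ n (f : ℕ → ℤ) → sumℤ (map f (upTo n)) ≡ ℤ∑.∑ n f
sumℤ-map-upTo n f = ≡.trans (≡.cong sumℤ (map-upTo f n)) (go n f)
  where
  go : ∀ n (f : ℕ → ℤ) → sumℤ (applyUpTo f n) ≡ ℤ∑.∑ n f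
  go zero    f = ≡.sym (ℤ∑.∑-empty f)
  go (suc n) f = ≡.trans (≡.cong (λ x → f 0 ℤ.+ x) (go n (f ∘ suc))) (≡.sym (ℤ∑.∑-first n f))

⊛-zero : ∀ f g → (f ⊛ g) 0 ≡ f 0 ℤ.* g 0
⊛-zero f g = ℤₚ.+-identityʳ _

⊛-∑ : ∀ f g n → (f ⊛ g) n ≡ ℤ∑.∑ (suc n) (λ k → f k ℤ.* g (n ∸ k))
⊛-∑ f g n = sumℤ-map-upTo (suc n) (λ k → f k ℤ.* g (n ∸ k))

⊛-suc : ∀ f g n → (f ⊛ g) (suc n) ≡ f 0 ℤ.* g (suc n) ℤ.+ (f ∘ suc ⊛ g) n
⊛-suc f g n = ≡.trans (⊛-∑ f g (suc n)) (≡.trans (ℤ∑.∑-first (suc n) _)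
  (≡.cong (λ x → f 0 ℤ.* g (suc n) ℤ.+ x) (≡.sym (⊛-∑ (f ∘ suc) g n))))

⊛-cong-at : ∀ n {f f′ g g′ : PS} → (∀ k → k ≤ n → f k ≡ f′ k) → (∀ k → k ≤ n → g k ≡ g′ k) →
            (f ⊛ g) n ≡ (f′ ⊛ g′) n
⊛-cong-at n {f} {f′} {g} {g′} f≡ g≡ = ≡.trans (⊛-∑ f g n) (≡.trans
  (ℤ∑.∑-cong (suc n) (λ k k<sn → ≡.cong₂ ℤ._*_ (f≡ k (ℕ.s≤s⁻¹ k<sn)) (g≡ (n ∸ k) (ℕₚ.m∸n≤m n k))))
  (≡.sym (⊛-∑ f′ g′ n)))

⊛-zeroʳ-at : ∀ n f → (f ⊛ (λ _ → 0ℤ)) n ≡ 0ℤ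
⊛-zeroʳ-at n f = ≡.trans (⊛-∑ f (λ _ → 0ℤ) n) (ℤ∑.∑-zero (suc n) (λ k _ → ℤₚ.*-zeroʳ (f k)))

⊛-zeroˡ-at : ∀ n f → ((λ _ → 0ℤ) ⊛ f) n ≡ 0ℤ
⊛-zeroˡ-at n f = ≡.trans (⊛-∑ (λ _ → 0ℤ) f n) (ℤ∑.∑-zero (suc n) (λ _ _ → ≡.refl))

⊛-distribʳ-at : ∀ n h f g → ((f ⊕ g) ⊛ h) n ≡ (f ⊛ h) n ℤ.+ (g ⊛ h) n
⊛-distribʳ-at n h f g = ≡.trans (⊛-∑ (f ⊕ g) h n) (≡.trans
  (ℤ∑.∑-cong (suc n) (λ k _ → ℤₚ.*-distribʳ-+ (h (n ∸ k)) (f k) (g k)))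
  (≡.trans (ℤ∑.∑-distrib-+ (suc n) _ _) (≡.sym (≡.cong₂ ℤ._+_ (⊛-∑ f h n) (⊛-∑ g h n)))))

⊛-scale-at : ∀ n c f g → ((λ k → c ℤ.* f k) ⊛ g) n ≡ c ℤ.* (f ⊛ g) n
⊛-scale-at n c f g = ≡.trans (⊛-∑ (λ k → c ℤ.* f k) g n) (≡.trans
  (ℤ∑.∑-cong (suc n) (λ k _ → ℤₚ.*-assoc c (f k) (g (n ∸ k))))
  (≡.trans (≡.sym (ℤ∑.*-distribˡ-∑ c (suc n) _)) (≡.cong (c ℤ.*_) (≡.sym (⊛-∑ f g n)))))

-- Peels the convolution at its other end; with `⊛-suc` it makes commutativity a plain induction on
-- the degree.
⊛-sucʳ : ∀ f g n → (f ⊛ g) (suc n) ≡ f (suc n) ℤ.* g 0 ℤ.+ (f ⊛ g ∘ suc) n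
⊛-sucʳ f g zero = ≡.trans (⊛-suc f g 0) (≡.trans
  (≡.cong₂ ℤ._+_ (≡.sym (⊛-zero f (g ∘ suc))) (⊛-zero (f ∘ suc) g))
  (ℤₚ.+-comm ((f ⊛ g ∘ suc) 0) (f 1 ℤ.* g 0)))
⊛-sucʳ f g (suc n) = begin
  (f ⊛ g) (suc (suc n))                                             ≡⟨ ⊛-suc f g (suc n) ⟩
  f 0 ℤ.* g (suc (suc n)) ℤ.+ (f ∘ suc ⊛ g) (suc n)                 ≡⟨ ≡.cong (λ x → f 0 ℤ.* g (suc (suc n)) ℤ.+ x) (⊛-sucʳ (f ∘ suc) g n) ⟩
  f 0 ℤ.* g (suc (suc n)) ℤ.+ (f (suc (suc n)) ℤ.* g 0 ℤ.+ (f ∘ suc ⊛ g ∘ suc) n)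
    ≡⟨ solve 3 (λ a b c → a :+ (b :+ c) := b :+ (a :+ c)) ≡.refl (f 0 ℤ.* g (suc (suc n))) (f (suc (suc n)) ℤ.* g 0) ((f ∘ suc ⊛ g ∘ suc) n) ⟩
  f (suc (suc n)) ℤ.* g 0 ℤ.+ (f 0 ℤ.* g (suc (suc n)) ℤ.+ (f ∘ suc ⊛ g ∘ suc) n)
    ≡⟨ ≡.cong (λ x → f (suc (suc n)) ℤ.* g 0 ℤ.+ x) (≡.sym (⊛-suc f (g ∘ suc) n)) ⟩
  f (suc (suc n)) ℤ.* g 0 ℤ.+ (f ⊛ g ∘ suc) (suc n)                 ∎
  where
  open ≡.≡-Reasoning
  open +-*-Solver

⊛-comm-at : ∀ n f g → (f ⊛ g) n ≡ (g ⊛ f) n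
⊛-comm-at zero    f g = ≡.trans (⊛-zero f g) (≡.trans (ℤₚ.*-comm (f 0) (g 0)) (≡.sym (⊛-zero g f)))
⊛-comm-at (suc n) f g = ≡.trans (⊛-suc f g n) (≡.trans
  (≡.cong₂ ℤ._+_ (ℤₚ.*-comm (f 0) (g (suc n))) (⊛-comm-at n (f ∘ suc) g))
  (≡.sym (⊛-sucʳ g f n)))

⊛-assoc-at : ∀ n f g h → ((f ⊛ g) ⊛ h) n ≡ (f ⊛ (g ⊛ h)) n
⊛-assoc-at zero f g h = begin
  ((f ⊛ g) ⊛ h) 0                ≡⟨ ⊛-zero (f ⊛ g) h ⟩
  (f ⊛ g) 0 ℤ.* h 0              ≡⟨ ≡.cong (ℤ._* h 0) (⊛-zero f g) ⟩
  f 0 ℤ.* g 0 ℤ.* h 0            ≡⟨ ℤₚ.*-assoc (f 0) (g 0) (h 0) ⟩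
  f 0 ℤ.* (g 0 ℤ.* h 0)          ≡⟨ ≡.cong (f 0 ℤ.*_) (≡.sym (⊛-zero g h)) ⟩
  f 0 ℤ.* (g ⊛ h) 0              ≡⟨ ≡.sym (⊛-zero f (g ⊛ h)) ⟩
  (f ⊛ (g ⊛ h)) 0                ∎
  where open ≡.≡-Reasoning
⊛-assoc-at (suc n) f g h = begin
  ((f ⊛ g) ⊛ h) (suc n)
    ≡⟨ ⊛-suc (f ⊛ g) h n ⟩
  (f ⊛ g) 0 ℤ.* h (suc n) ℤ.+ ((f ⊛ g) ∘ suc ⊛ h) n
    -- The tail of f ⊛ g is f 0 times the tail of g plus the product of the tail of f with g;
    -- linearity then lowers the degree.
    ≡⟨ ≡.cong₂ ℤ._+_ (≡.cong (ℤ._* h (suc n)) (⊛-zero f g)) (⊛-cong-at n {(f ⊛ g) ∘ suc} {(λ k → f 0 ℤ.* g (suc k)) ⊕ (f ∘ suc ⊛ g)} {h} {h} (λ k _ → ⊛-suc f g k) (λ _ _ → ≡.refl)) ⟩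
  f 0 ℤ.* g 0 ℤ.* h (suc n) ℤ.+ (((λ k → f 0 ℤ.* g (suc k)) ⊕ (f ∘ suc ⊛ g)) ⊛ h) n
    ≡⟨ ≡.cong (λ x → f 0 ℤ.* g 0 ℤ.* h (suc n) ℤ.+ x) (≡.trans (⊛-distribʳ-at n h (λ k → f 0 ℤ.* g (suc k)) (f ∘ suc ⊛ g))
         (≡.cong₂ ℤ._+_ (⊛-scale-at n (f 0) (g ∘ suc) h) (⊛-assoc-at n (f ∘ suc) g h))) ⟩
  f 0 ℤ.* g 0 ℤ.* h (suc n) ℤ.+ (f 0 ℤ.* (g ∘ suc ⊛ h) n ℤ.+ (f ∘ suc ⊛ (g ⊛ h)) n)
    ≡⟨ solve 5 (λ a b c d e → a :* b :* c :+ (a :* d :+ e) := a :* (b :* c :+ d) :+ e) ≡.refl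
         (f 0) (g 0) (h (suc n)) ((g ∘ suc ⊛ h) n) ((f ∘ suc ⊛ (g ⊛ h)) n) ⟩
  f 0 ℤ.* (g 0 ℤ.* h (suc n) ℤ.+ (g ∘ suc ⊛ h) n) ℤ.+ (f ∘ suc ⊛ (g ⊛ h)) n
    ≡⟨ ≡.cong (λ x → f 0 ℤ.* x ℤ.+ (f ∘ suc ⊛ (g ⊛ h)) n) (≡.sym (⊛-suc g h n)) ⟩
  f 0 ℤ.* (g ⊛ h) (suc n) ℤ.+ (f ∘ suc ⊛ (g ⊛ h)) n
    ≡⟨ ≡.sym (⊛-suc f (g ⊛ h) n) ⟩
  (f ⊛ (g ⊛ h)) (suc n) ∎
  where
  open ≡.≡-Reasoning
  open +-*-Solver

⊛-identityˡ-at : ∀ n f → (one ⊛ f) n ≡ f n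
⊛-identityˡ-at zero    f = ≡.trans (⊛-zero one f) (ℤₚ.*-identityˡ (f 0))
⊛-identityˡ-at (suc n) f = ≡.trans (⊛-suc one f n)
  (≡.trans (≡.cong₂ ℤ._+_ (ℤₚ.*-identityˡ (f (suc n))) (⊛-zeroˡ-at n f)) (ℤₚ.+-identityʳ _))

-- A record rather than a function type, so that the two series can be inferred from the type of a
-- proof.
record Agree (n : ℕ) (f g : PS) : Set where
  constructor agree
  field
    at : ∀ k → k ≤ n → f k ≡ g k

open Agree

-- Sealed copies of the operations: _⊛_ and _⊕_ compute on coefficients, which blocks unification.
opaque
  infixl 7 _·_
  infixl 6 _∔_

  _·_ _∔_ : PS → PS → PS
  _·_ = _⊛_
  _∔_ = _⊕_

  neg : PS → PS
  neg f k = ℤ.- f k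

  ⊛≡· : ∀ f g → f ⊛ g ≡ f · g
  ⊛≡· f g = ≡.refl

  ⊖≡∔neg : ∀ f g → f ⊖ g ≡ f ∔ neg g
  ⊖≡∔neg f g = ≡.refl

  ∔-at : ∀ f g i → (f ∔ g) i ≡ f i ℤ.+ g i
  ∔-at f g i = ≡.refl

  PS-isCommutativeRing : ∀ n → IsCommutativeRing (Agree n) _∔_ _·_ neg (λ _ → 0ℤ) one
  PS-isCommutativeRing n = record
    { isRing = record
      { +-isAbelianGroup = record
        { isGroup = record
          { isMonoid = record
            { isSemigroup = record
              { isMagma = record
                { isEquivalence = record
                  { refl  = agree (λ _ _ → ≡.refl)
                  ; sym   = λ p → agree (λ k k≤n → ≡.sym (at p k k≤n))
                  ; trans = λ p p′ → agree (λ k k≤n → ≡.trans (at p k k≤n) (at p′ k k≤n))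
                  }
                ; ∙-cong = λ p p′ → agree (λ k k≤n → ≡.cong₂ ℤ._+_ (at p k k≤n) (at p′ k k≤n))
                }
              ; assoc = λ f g h → agree (λ k _ → ℤₚ.+-assoc (f k) (g k) (h k))
              }
            ; identity = (λ f → agree (λ k _ → ℤₚ.+-identityˡ (f k)))
                       , (λ f → agree (λ k _ → ℤₚ.+-identityʳ (f k)))
            }
          ; inverse = (λ f → agree (λ k _ → ℤₚ.+-inverseˡ (f k)))
                    , (λ f → agree (λ k _ → ℤₚ.+-inverseʳ (f k)))
          ; ⁻¹-cong = λ p → agree (λ k k≤n → ≡.cong ℤ.-_ (at p k k≤n))
          }
        ; comm = λ f g → agree (λ k _ → ℤₚ.+-comm (f k) (g k))
        }
      ; *-cong = λ p p′ → agree (λ k k≤n → ⊛-cong-at k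
          (λ i i≤k → at p i (ℕₚ.≤-trans i≤k k≤n)) (λ i i≤k → at p′ i (ℕₚ.≤-trans i≤k k≤n)))
      ; *-assoc = λ f g h → agree (λ k _ → ⊛-assoc-at k f g h)
      ; *-identity = (λ f → agree (λ k _ → ⊛-identityˡ-at k f))
                   , (λ f → agree (λ k _ → ≡.trans (⊛-comm-at k f one) (⊛-identityˡ-at k f)))
      ; distrib = (λ h f g → agree (λ k _ → ≡.trans (⊛-comm-at k h (f ⊕ g)) (≡.trans (⊛-distribʳ-at k h f g)
                     (≡.cong₂ ℤ._+_ (⊛-comm-at k f h) (⊛-comm-at k g h)))))
                , (λ h f g → agree (λ k _ → ⊛-distribʳ-at k h f g))
      }
    ; *-comm = λ f g → agree (λ k _ → ⊛-comm-at k f g)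
    }

PS-mod : ℕ → CommutativeRing 0ℓ 0ℓ
PS-mod n = record { isCommutativeRing = PS-isCommutativeRing n }

X^-large : ∀ k i → i < k → X^ k i ≡ 0ℤ
X^-large (suc k) zero    _         = ≡.refl
X^-large (suc k) (suc i) (s≤s i<k) = X^-large k i i<k

X^1-suc : ∀ k i → (X^ 1 ⊛ X^ k) i ≡ X^ (suc k) i
X^1-suc k zero    = ⊛-zero (X^ 1) (X^ k)
X^1-suc k (suc i) = ≡.trans (⊛-suc (X^ 1) (X^ k) i) (≡.trans (ℤₚ.+-identityˡ ((X^ 1 ∘ suc ⊛ X^ k) i))
  (≡.trans (⊛-cong-at i {X^ 1 ∘ suc} {one} {X^ k} {X^ k} (λ { zero _ → ≡.refl ; (suc _) _ → ≡.refl }) (λ _ _ → ≡.refl)) (⊛-identityˡ-at i (X^ k))))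

-- Each factor u raises the order by at least one. This is what makes the geometric series in `inv`
-- finite.
^ps-large : ∀ u → u 0 ≡ 0ℤ → ∀ k i → i < k → (u ^ps k) i ≡ 0ℤ
^ps-large u u₀ (suc k) zero    _         = ≡.trans (⊛-zero u (u ^ps k)) (≡.cong (ℤ._* (u ^ps k) 0) u₀)
^ps-large u u₀ (suc k) (suc i) (s≤s i<k) = ≡.trans (⊛-suc u (u ^ps k) i) (≡.cong₂ ℤ._+_
  (≡.cong (ℤ._* (u ^ps k) (suc i)) u₀)
  (≡.trans (⊛-cong-at i {u ∘ suc} {u ∘ suc} {u ^ps k} {λ _ → 0ℤ} (λ _ _ → ≡.refl) (λ j j≤i → ^ps-large u u₀ k j (ℕₚ.≤-<-trans j≤i i<k))) (⊛-zeroʳ-at i (u ∘ suc))))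

qPoch-constant : ∀ c d N → qPoch (suc c) d N 0 ≡ 1ℤ
qPoch-constant c d zero    = ≡.refl
qPoch-constant c d (suc N) = ≡.trans (⊛-zero (qPoch (suc c) d N) (one ⊖ X^ (suc c ℕ.+ d ℕ.* N))) (≡.cong (ℤ._* 1ℤ) (qPoch-constant c d N))

qbin-≤ : ∀ {N M} → M ≤ N → qbin N M ≡ qq N ⊛ inv (qq M) ⊛ inv (qq (N ∸ M))
qbin-≤ {N} {M} M≤N with M ℕₚ.≤? N
... | yes _   = ≡.refl
... | no  M≰N = contradiction M≤N M≰N

qbin-> : ∀ {N M} → N < M → qbin N M ≡ (λ _ → 0ℤ)
qbin-> {N} {M} N<M with M ℕₚ.≤? N
... | yes M≤N = contradiction M≤N (ℕₚ.<⇒≱ N<M)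
... | no  _   = ≡.refl

sumℤ-++ : ∀ xs ys → sumℤ (xs ++ ys) ≡ sumℤ xs ℤ.+ sumℤ ys
sumℤ-++ []       ys = ≡.sym (ℤₚ.+-identityˡ _)
sumℤ-++ (x ∷ xs) ys = ≡.trans (≡.cong (λ s → x ℤ.+ s) (sumℤ-++ xs ys)) (≡.sym (ℤₚ.+-assoc x _ _))

sumℤ-concatMap : ∀ {A B : Set} (g : B → ℤ) (h : A → List B) xs →
                 sumℤ (map g (concatMap h xs)) ≡ sumℤ (map (λ x → sumℤ (map g (h x))) xs)
sumℤ-concatMap g h []       = ≡.refl
sumℤ-concatMap g h (x ∷ xs) = ≡.trans (≡.cong sumℤ (map-++ g (h x) (concatMap h xs)))
  (≡.trans (sumℤ-++ (map g (h x)) _) (≡.cong (λ s → sumℤ (map g (h x)) ℤ.+ s) (sumℤ-concatMap g h xs)))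

triangular-suc : ∀ x → suc (suc x) C 2 ≡ (suc x C 2) ℕ.+ suc x
triangular-suc x = ≡.trans (≡.sym (nCk+nC[k+1]≡[n+1]C[k+1] (suc x) 1))
  (≡.trans (≡.cong (ℕ._+ (suc x C 2)) (nC1≡n (suc x))) (ℕₚ.+-comm (suc x) (suc x C 2)))

lookup≤sumBinom : ∀ {m} (N : Vec ℕ m) i → lookup N i ≤ sumBinom N
lookup≤sumBinom (zero  ∷ N) zero    = z≤n
lookup≤sumBinom (suc x ∷ N) zero    = ℕₚ.≤-trans
  (ℕₚ.≤-trans (ℕₚ.m≤n+m (suc x) (suc x C 2)) (ℕₚ.≤-reflexive (≡.sym (triangular-suc x)))) (ℕₚ.m≤m+n _ (sumBinom N))
lookup≤sumBinom (x ∷ N)     (suc i) = ℕₚ.≤-trans (lookup≤sumBinom N i) (ℕₚ.m≤n+m _ (suc x C 2))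

-- The series of the statement, read in the ring modulo q^(n+1).

module Modulo (n : ℕ) where
  R = PS-mod n
  open CommutativeRing R renaming (zero to *-zero)
  open IntegerSolver R
  open FiniteSums R
  open import Algebra.Properties.Semiring.Exp semiring using (_^_; ^-homo-*; ^-assocʳ)
  open import Relation.Binary.Reasoning.Setoid setoid

  q : PS
  q = X^ 1

  ⊛⊛≈ : ∀ f g h → f ⊛ g ⊛ h ≈ f * g * h
  ⊛⊛≈ f g h = reflexive (≡.trans (⊛≡· (f ⊛ g) h) (≡.cong (_· h) (⊛≡· f g)))

  ∑-at : ∀ m (g : ℕ → PS) i → i ≤ n → ∑ m g i ≡ ℤ∑.∑ m (λ k → g k i)
  ∑-at zero    g i i≤n = ≡.trans (at (∑-empty g) i i≤n) (≡.sym (ℤ∑.∑-empty _))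
  ∑-at (suc m) g i i≤n = ≡.trans (≡.trans (at (∑-first m g) i i≤n) (∔-at (g 0) (∑ m (g ∘ suc)) i))
    (≡.trans (≡.cong (λ x → g 0 i ℤ.+ x) (∑-at m (g ∘ suc) i i≤n)) (≡.sym (ℤ∑.∑-first m _)))

  X^-power : ∀ k → X^ k ≈ q ^ k
  X^-power zero    = agree λ { zero _ → ≡.refl ; (suc _) _ → ≡.refl }
  X^-power (suc k) = trans (agree (λ i _ → ≡.sym (X^1-suc k i))) (trans (reflexive (⊛≡· q (X^ k))) (*-congˡ (X^-power k)))

  q-vanish : ∀ k → n < k → q ^ k ≈ 0#
  q-vanish k n<k = trans (sym (X^-power k)) (agree (λ i i≤n → X^-large k i (ℕₚ.≤-<-trans i≤n n<k)))

  X^-+ : ∀ a b → X^ (a ℕ.+ b) ≈ X^ a * X^ b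
  X^-+ a b = trans (X^-power (a ℕ.+ b)) (trans (^-homo-* q a b) (sym (*-cong (X^-power a) (X^-power b))))

  qPoch-suc : ∀ c d N → qPoch c d (suc N) ≈ qPoch c d N * (1# - X^ (c ℕ.+ d ℕ.* N))
  qPoch-suc c d N = trans (reflexive (⊛≡· (qPoch c d N) (one ⊖ X^ (c ℕ.+ d ℕ.* N))))
    (*-congˡ (reflexive (⊖≡∔neg one (X^ (c ℕ.+ d ℕ.* N)))))

  qPoch≈poch : ∀ c d N → qPoch c d N ≈ QSeries.poch R (q ^ d) (q ^ c) N
  qPoch≈poch c d zero    = refl
  qPoch≈poch c d (suc N) = trans (qPoch-suc c d N) (*-cong (qPoch≈poch c d N) (+-congˡ (-‿cong (begin
    X^ (c ℕ.+ d ℕ.* N)     ≈⟨ X^-power (c ℕ.+ d ℕ.* N) ⟩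
    q ^ (c ℕ.+ d ℕ.* N)    ≈⟨ ^-homo-* q c (d ℕ.* N) ⟩
    q ^ c * q ^ (d ℕ.* N)  ≈⟨ *-congˡ (^-assocʳ q d N) ⟨
    q ^ c * (q ^ d) ^ N    ∎))))

  qPoch1≈poch : ∀ d N → qPoch 1 d N ≈ QSeries.poch R (q ^ d) q N
  qPoch1≈poch d N = trans (qPoch≈poch 1 d N) (QSeries.poch-cong R (q ^ d) N (*-identityʳ q))

  qq≈poch : ∀ N → qq N ≈ QSeries.poch R q q N
  qq≈poch zero    = refl
  qq≈poch (suc N) = trans (qPoch-suc 1 1 N) (*-cong (qq≈poch N) (+-congˡ (-‿cong
    (trans (reflexive (≡.cong (λ k → X^ (suc k)) (ℕₚ.+-identityʳ N))) (X^-power (suc N))))))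

  -- Geometric series for 1 / (1 - u) with u = 1 - f.
  inv-inverse : ∀ f → f 0 ≡ 1ℤ → inv f * f ≈ 1#
  inv-inverse f f₀ = begin
    inv f * f                                    ≈⟨ *-comm _ _ ⟩
    f * inv f                                    ≈⟨ *-congˡ inv≈∑ ⟩
    f * ∑ (suc n) (u ^ps_)                       ≈⟨ *-distribˡ-∑ f (suc n) _ ⟩
    ∑ (suc n) (λ k → f * u ^ps k)                ≈⟨ ∑-cong (suc n) (λ k _ → term k) ⟩
    ∑ (suc n) (λ k → u ^ps k - u ^ps (suc k))    ≈⟨ ∑-telescope (suc n) (u ^ps_) ⟩
    1# - u ^ps (suc n)                           ≈⟨ +-congˡ (-‿cong (agree (λ i i≤n → ^ps-large u u₀ (suc n) i (s≤s i≤n)))) ⟩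
    1# - 0#                                      ≈⟨ solve 0 (:1 :- con (+ 0) := :1) refl ⟩
    1#                                           ∎
    where
    u : PS
    u = one ⊖ f
    u₀ : u 0 ≡ 0ℤ
    u₀ = ≡.cong (λ x → 1ℤ ℤ.- x) f₀
    term : ∀ k → f * u ^ps k ≈ u ^ps k - u ^ps (suc k)
    term k = begin
      f * u ^ps k                                ≈⟨ solve 2 (λ f p → f :* p := p :- (:1 :- f) :* p) refl f (u ^ps k) ⟩
      u ^ps k - (1# - f) * u ^ps k               ≡⟨ ≡.cong (λ g → u ^ps k - g * u ^ps k) (⊖≡∔neg one f) ⟨
      u ^ps k - u * u ^ps k                      ≡⟨ ≡.cong (λ g → u ^ps k - g) (⊛≡· u (u ^ps k)) ⟨
      u ^ps k - u ^ps (suc k)                    ∎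
    inv≈∑ : inv f ≈ ∑ (suc n) (u ^ps_)
    -- The coefficient of `inv f` at i stops at k = i; the powers from there up to n vanish at i, so
    -- one range serves all i ≤ n.
    inv≈∑ = agree (λ i i≤n → ≡.trans (sumℤ-map-upTo (suc i) _) (≡.trans
      (≡.sym (ℤ∑.∑-extend (λ k i<k → ^ps-large u u₀ k i i<k) (s≤s i≤n)))
      (≡.sym (∑-at (suc n) (u ^ps_) i i≤n))))

  r : ℕ → PS
  r k = inv (qq k)

  r-inverse : ∀ k → r k * QSeries.poch R q q k ≈ 1#
  r-inverse k = trans (*-congˡ (sym (qq≈poch k))) (inv-inverse (qq k) (qPoch-constant 0 1 k))

  open Bailey R q r r-inverse using (rs; rs-+; rs-large; tri)
  open BaileyPairs R q r r-inverse using (qbinom)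
  open Truncated R q r r-inverse n q-vanish public

  qbin≈qbinom : ∀ N M → qbin N M ≈ qbinom N M
  qbin≈qbinom N M = Sum.[ inside , outside ]′ (ℕₚ.≤-<-connex M N)
    where
    inside : M ≤ N → qbin N M ≈ qbinom N M
    inside M≤N = begin
      qbin N M
        ≡⟨ qbin-≤ M≤N ⟩
      qq N ⊛ r M ⊛ r (N ∸ M)
        ≈⟨ ⊛⊛≈ (qq N) (r M) (r (N ∸ M)) ⟩
      qq N * r M * r (N ∸ M)
        ≈⟨ *-assoc (qq N) (r M) (r (N ∸ M)) ⟩
      qq N * (r M * r (N ∸ M))
        ≈⟨ *-cong (qq≈poch N) (*-congˡ (reflexive (≡.trans (≡.sym (rs-+ M (N ∸ M))) (≡.cong (λ k → rs k M) (ℕₚ.m+[n∸m]≡n M≤N))))) ⟩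
      qbinom N M ∎
    outside : N < M → qbin N M ≈ qbinom N M
    outside N<M = trans (reflexive (qbin-> N<M)) (sym (trans (*-congˡ (trans (*-congˡ (rs-large N<M)) (zeroʳ _))) (zeroʳ _)))

  X^-tri : ∀ x → X^ (suc x C 2) ≈ tri x
  X^-tri zero    = X^-power 0
  X^-tri (suc x) = begin
    X^ (suc (suc x) C 2)          ≡⟨ ≡.cong X^ (triangular-suc x) ⟩
    X^ ((suc x C 2) ℕ.+ suc x)    ≈⟨ X^-+ (suc x C 2) (suc x) ⟩
    X^ (suc x C 2) * X^ (suc x)   ≈⟨ *-cong (X^-tri x) (X^-power (suc x)) ⟩
    tri (suc x)                   ∎

  X^-triangle : ∀ {m} (v : Vec ℕ m) → X^ (sumBinom v) ≈ triangle v
  X^-triangle []      = X^-power 0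
  X^-triangle (x ∷ v) = trans (X^-+ (suc x C 2) (sumBinom v)) (*-cong (X^-tri x) (X^-triangle v))

  chain≈links : ∀ a i {k} (v : Vec ℕ k) → chain a i v ≈ links a i v
  chain≈links a i []          = refl
  chain≈links a i (x ∷ [])    = refl
  chain≈links a i (x ∷ y ∷ v) = trans (reflexive (⊛≡· (qbin (x ℕ.+ δ a i) y) (chain a (suc i) (y ∷ v)))) (*-cong (qbin≈qbinom (x ℕ.+ δ a i) y) (chain≈links a (suc i) (y ∷ v)))

  ∑box-at : ∀ m (F : Vec ℕ m → PS) i → i ≤ n → sumℤ (map (λ N → F N i) (box n m)) ≡ ∑box m F i
  ∑box-at zero    F i i≤n = ℤₚ.+-identityʳ _
  ∑box-at (suc m) F i i≤n = ≡.trans (sumℤ-concatMap (λ N → F N i) (λ x → map (x ∷_) (box n m)) (upTo (suc n)))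
    (≡.trans (sumℤ-map-upTo (suc n) _)
      (≡.trans (ℤ∑.∑-cong (suc n) (λ x _ → ≡.trans (≡.cong sumℤ (≡.sym (map-∘ (box n m)))) (∑box-at m (λ v → F (x ∷ v)) i i≤n)))
        (≡.sym (∑-at (suc n) _ i i≤n))))

  summand-total : ∀ a k → ∑box (suc k) (summand a) ≈ total a k
  summand-total a k = ∑-cong (suc n) (λ x _ → begin
    ∑box k (λ v → summand a (x ∷ v))
      ≈⟨ ∑box-cong k (λ v → trans (⊛⊛≈ (X^ (sumBinom (x ∷ v))) (r x) (chain a 1 (x ∷ v))) (*-cong (*-congʳ (X^-triangle (x ∷ v))) (chain≈links a 1 (x ∷ v)))) ⟩
    ∑box k (λ v → tri x * triangle v * r x * links a 1 (x ∷ v))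
      ≈⟨ ∑box-cong k (λ v → solve 4 (λ t T r l → t :* T :* r :* l := t :* (r :* (T :* l))) refl (tri x) (triangle v) (r x) (links a 1 (x ∷ v))) ⟩
    ∑box k (λ v → tri x * (r x * (triangle v * links a 1 (x ∷ v))))
      ≈⟨ *-distribˡ-∑box (tri x) k _ ⟨
    tri x * ∑box k (λ v → r x * (triangle v * links a 1 (x ∷ v)))
      ≈⟨ *-congˡ (*-distribˡ-∑box (r x) k _) ⟨
    tri x * (r x * chain-sum a 1 k x) ∎)

  summand-vanish : ∀ a {m} (N : Vec ℕ m) → n < sumBinom N → summand a N ≈ 0#
  summand-vanish a N n<s = trans (⊛⊛≈ (X^ (sumBinom N)) (firstFactor N) (chain a 1 N)) (trans (*-congʳ (trans (*-congʳ (trans (X^-power (sumBinom N)) (q-vanish (sumBinom N) n<s))) (zeroˡ _))) (zeroˡ _))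

  qPoch-stable : ∀ c d {k} → n ≤ k → qPoch (suc c) (suc d) k ≈ qPoch (suc c) (suc d) n
  qPoch-stable c d {k} n≤k = trans (qPoch≈poch (suc c) (suc d) k)
    (trans (QSeries.poch-stable R (q ^ suc d) (power-vanish c d) n≤k) (sym (qPoch≈poch (suc c) (suc d) n)))

  lhs· : ℕ → ℕ → PS
  lhs· m a = qPochInf (suc a) (m ℕ.+ 2) * qPochInf (m ℕ.+ 1 ∸ a) (m ℕ.+ 2) * qPochInf (m ℕ.+ 2) (m ℕ.+ 2)
             * inv (qPochInf 1 1) * inv (qPochInf 1 2)

  lhs≈ : ∀ m a → lhs m a ≈ lhs· m a
  lhs≈ m a = trans (⊛⊛≈ (z ⊛ w ⊛ p) (inv (qPochInf 1 1)) (inv (qPochInf 1 2))) (*-congʳ (*-congʳ (⊛⊛≈ z w p)))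
    where
    z w p : PS
    z = qPochInf (suc a) (m ℕ.+ 2)
    w = qPochInf (m ℕ.+ 1 ∸ a) (m ℕ.+ 2)
    p = qPochInf (m ℕ.+ 2) (m ℕ.+ 2)

-- Assembly of the identity, coefficient by coefficient.

qPochInf≈qPoch : ∀ n c d → Agree n (qPochInf (suc c) (suc d)) (qPoch (suc c) (suc d) n)
qPochInf≈qPoch n c d = agree (λ i i≤n → ≡.trans
  -- For each i the comparison is made modulo q^(i+1), where the products with i + 1 and with n
  -- factors both agree with the one with i factors.
  (at (Modulo.qPoch-stable i c d (ℕₚ.n≤1+n i)) i ℕₚ.≤-refl)
  (≡.sym (at (Modulo.qPoch-stable i c d i≤n) i ℕₚ.≤-refl)))

product-side : ∀ n d e → Agree n (lhs (suc d ℕ.+ e) (suc d)) (Modulo.∑box n (suc (d ℕ.+ e)) (summand (suc d)))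
product-side n d e = begin
  lhs (suc d ℕ.+ e) (suc d)
    ≈⟨ lhs≈ (suc d ℕ.+ e) (suc d) ⟩
  lhs· (suc d ℕ.+ e) (suc d)
    ≡⟨ ≡.cong₂ (λ Q w → qPochInf (suc (suc d)) Q * qPochInf w Q * qPochInf Q Q * inv (qPochInf 1 1) * inv (qPochInf 1 2))
         (ℕₚ.+-comm (suc d ℕ.+ e) 2) w≡ ⟩
  qPochInf (suc (suc d)) Q * qPochInf (suc e) Q * qPochInf Q Q * inv (qPochInf 1 1) * inv (qPochInf 1 2)
    ≈⟨ *-cong (*-cong (*-cong (*-cong (limit (suc d)) (limit e)) (limit (suc (suc (d ℕ.+ e))))) r≈) refl ⟩
  pochQ (q ^ suc (suc d)) * pochQ (q ^ suc e) * pochQ (q ^ Q) * r n * inv (qPochInf 1 2)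
    ≈⟨ total-product d e {u = inv (qPoch Q Q n)}
         (trans (*-congˡ (sym (qPoch≈poch Q Q n))) (inv-inverse (qPoch Q Q n) (qPoch-constant _ Q n)))
         (trans (*-congˡ (trans (sym (qPoch1≈poch 2 n)) (sym (qPochInf≈qPoch n 0 1)))) (inv-inverse (qPochInf 1 2) ≡.refl)) ⟨
  total (suc d) (d ℕ.+ e)
    ≈⟨ summand-total (suc d) (d ℕ.+ e) ⟨
  ∑box (suc (d ℕ.+ e)) (summand (suc d)) ∎
  where
  open Modulo n
  open CommutativeRing R
  open import Algebra.Properties.Semiring.Exp semiring using (_^_)
  open import Relation.Binary.Reasoning.Setoid setoid
  open Bailey R q r r-inverse using (cancelˡ)
  Q = suc (suc (suc (d ℕ.+ e)))
  pochQ : PS → PS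
  pochQ z = QSeries.poch R (q ^ Q) z n
  w≡ : suc d ℕ.+ e ℕ.+ 1 ∸ suc d ≡ suc e
  w≡ = ≡.trans (≡.cong (_∸ suc d) (ℕₚ.+-assoc (suc d) e 1)) (≡.trans (ℕₚ.m+n∸m≡n (suc d) (e ℕ.+ 1)) (ℕₚ.+-comm e 1))
  limit : ∀ c → qPochInf (suc c) Q ≈ pochQ (q ^ suc c)
  limit c = trans (qPochInf≈qPoch n c (suc (suc (d ℕ.+ e)))) (qPoch≈poch (suc c) Q n)
  r≈ : inv (qPochInf 1 1) ≈ r n
  -- Both are reciprocals of (q)_n modulo q^(n+1), so uniqueness replaces a proof that `inv`
  -- respects `Agree`.
  r≈ = cancelˡ (r-inverse n) (begin
    QSeries.poch R q q n * inv (qPochInf 1 1)    ≈⟨ *-comm _ _ ⟩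
    inv (qPochInf 1 1) * QSeries.poch R q q n    ≈⟨ *-congˡ (trans (qPochInf≈qPoch n 0 0) (qq≈poch n)) ⟨
    inv (qPochInf 1 1) * qPochInf 1 1            ≈⟨ inv-inverse (qPochInf 1 1) ≡.refl ⟩
    1#                                           ≈⟨ r-inverse n ⟨
    r n * QSeries.poch R q q n                   ≈⟨ *-comm _ _ ⟩
    QSeries.poch R q q n * r n                   ∎)

-- The bound for the coefficient of q^n is n itself: an index above n forces `sumBinom` above n,
-- since x ≤ x(x+1)/2.
isSum : ∀ {m} a (S : PS) → (∀ n → Agree n S (Modulo.∑box n m (summand a))) → IsSum {m} (summand a) S
isSum {m} a S S≈ n = n , bounded , ≡.trans (at (S≈ n) n ℕₚ.≤-refl) (≡.sym (Modulo.∑box-at n m (summand a) n ℕₚ.≤-refl))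
  where
  bounded : ∀ N → _ → ∀ i → lookup N i ≤ n
  bounded N nonzero i with lookup N i ℕₚ.≤? n
  ... | yes N≤n = N≤n
  ... | no  N≰n = contradiction
    (at (Modulo.summand-vanish n a N (ℕₚ.<-≤-trans (ℕₚ.≰⇒> N≰n) (lookup≤sumBinom N i))) n ℕₚ.≤-refl) nonzero

-- The k entries have only k - 1 links, at indices i + 1, ..., i + k - 1, all below a, so neither
-- chain meets its delta.
chain-0≡m : ∀ {a} i {k} (v : Vec ℕ k) → i ℕ.+ k ≤ a → chain 0 (suc i) v ≡ chain a (suc i) v
chain-0≡m i []          _ = ≡.refl
chain-0≡m i (x ∷ [])    _ = ≡.refl
chain-0≡m {a} i {suc (suc k)} (x ∷ y ∷ v) i+k≤a = ≡.cong₂ (λ δᵢ c → qbin (x ℕ.+ δᵢ) y ⊛ c)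
  (≡.sym (δ-> (ℕₚ.≤-trans (ℕₚ.≤-trans (ℕₚ.≤-reflexive (≡.sym (ℕₚ.+-comm i 2))) (ℕₚ.+-monoʳ-≤ i (s≤s (s≤s z≤n)))) i+k≤a)))
  (chain-0≡m (suc i) (y ∷ v) (ℕₚ.≤-trans (ℕₚ.≤-reflexive (≡.sym (ℕₚ.+-suc i (suc k)))) i+k≤a))

-- For a = 0 no delta occurs; this is the case a = m with the first two products exchanged.
lhs-0≈m : ∀ n m → Agree n (lhs m 0) (lhs m m)
lhs-0≈m n m = trans (lhs≈ m 0) (trans (*-congʳ (*-congʳ (*-congʳ (trans (*-comm _ _)
  (*-cong (reflexive (≡.cong (λ k → qPochInf k (m ℕ.+ 2)) (ℕₚ.+-comm m 1)))
          (reflexive (≡.cong (λ k → qPochInf k (m ℕ.+ 2)) (≡.sym (ℕₚ.m+n∸m≡n m 1))))))))) (sym (lhs≈ m m)))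
  where
  open Modulo n
  open CommutativeRing (PS-mod n)

product-side-zero : ∀ n k → Agree n (lhs (suc k) 0) (Modulo.∑box n (suc k) (summand 0))
product-side-zero n k = begin
  lhs (suc k) 0
    ≈⟨ lhs-0≈m n (suc k) ⟩
  lhs (suc k) (suc k)
    ≈⟨ ≡.subst (λ m → lhs m (suc k) ≈ ∑box m (summand (suc k))) (ℕₚ.+-identityʳ (suc k)) (product-side n k 0) ⟩
  ∑box (suc k) (summand (suc k))
    ≈⟨ ∑box-cong (suc k) (λ v → reflexive (≡.cong (X^ (sumBinom v) ⊛ firstFactor v ⊛_) (≡.sym (chain-0≡m 0 v ℕₚ.≤-refl)))) ⟩
  ∑box (suc k) (summand 0) ∎
  where
  open Modulo n
  open CommutativeRing (PS-mod n)
  open import Relation.Binary.Reasoning.Setoid setoid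

theorem5p3 : (m a : ℕ) → 1 ≤ m → a ≤ m → IsSum {m} (summand a) (lhs m a)
theorem5p3 (suc k) zero    1≤m a≤m = isSum 0 (lhs (suc k) 0) (λ n → product-side-zero n k)
theorem5p3 m       (suc d) 1≤m a≤m = isSum (suc d) (lhs m (suc d)) (λ n →
  ≡.subst (λ m → Agree n (lhs m (suc d)) (Modulo.∑box n m (summand (suc d)))) (ℕₚ.m+[n∸m]≡n a≤m) (product-side n d (m ∸ suc d)))
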